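{- (1) A biconnected graph $G$ is critical if and only if every part of $G$ that is a block and every part of $G$ that is a cycle of length $3$ has empty interior. (2) Let $G$ be a critical biconnected graph, let $A\in\mathrm{Part}(G)$ be a terminal part, and let $S$ be the single cutset adjacent to $A$ in $\mathrm{BT}(G)$. Then $A$ is a cycle with at least four vertices, and every vertex of $A$ other than the two vertices of $S$ has degree $2$ in $G$. (3) Every critical biconnected graph has at least four vertices of degree $2$.
   Context: All graphs are finite, undirected, without loops or multiple edges; $G(U)$ is the subgraph induced on $U$. A connected component means the vertex set of a maximal connected subgraph. A set $R\subset V(G)$ is a cutset if $G-R$ (delete the vertices of $R$) is disconnected; $\mathfrak R_2(G)$ is the set of 2-vertex cutsets. $R$ separates $X$ from $Y$ (where $X,Y\not\subset R$) if no vertex of $X\setminus R$ and no vertex of $Y\setminus R$ lie in a common connected component of $G-R$; $R$ splits $X$ if $X\setminus R$ is not contained in one connected component of $G-R$. $G$ is $k$-connected if $v(G)>k$ and it has no cutset with at most $k-1$ vertices; biconnected = 2-connected, triconnected = 3-connected. A biconnected graph $G$ is critical if $v(G)\ge 4$ and for every vertex $x$ the graph $G-x$ is not biconnected. Cutsets $S,T\in\mathfrak R_2(G)$ are independent if neither splits the other; $S$ is single if it is independent with all other cutsets in $\mathfrak R_2(G)$; $\mathfrak O(G)$ is the set of single cutsets. A set $A\subset V(G)$ is a part of $G$ if no cutset of $\mathfrak O(G)$ splits $A$ but every vertex outside $A$ is separated from $A$ by some cutset of $\mathfrak O(G)$; $\mathrm{Part}(G)$ is the set of parts. The interior $\mathrm{Int}(A)$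 of a part is the set of its vertices lying in no single cutset. $\mathrm{BT}(G)$ is the bipartite graph (a tree) whose vertices are the single cutsets and the parts of $G$, a cutset $S$ being adjacent to a part $A$ iff $S\subset A$; a part is terminal if it is a leaf of $\mathrm{BT}(G)$. $G'$ is obtained from $G$ by adding all edges $ab$ with $\{a,b\}\in\mathfrak O(G)$. A part $A$ is a block if $G'(A)$ is triconnected, and a cycle of length $|A|$ if $G'(A)$ is a simple cycle. -}

module Defs where

open import Data.Nat using (ℕ; zero; suc; _+_; _<_; _≤_)
open import Data.Nat.DivMod using (_%_)
open import Data.Bool using (Bool; true; false; T)
open import Data.Fin using (Fin; toℕ)
open import Data.Fin.Subset using (Subset; _∈_; _∉_; _⊆_; ∁; _∩_; _∪_; ⁅_⁆; ∣_∣; ⊤)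
open import Data.Vec using (tabulate)
open import Data.Product using (Σ; ∃; ∃-syntax; _×_; _,_)
open import Data.Sum using (_⊎_)
open import Relation.Nullary using (¬_; ⌊_⌋)
open import Relation.Binary.PropositionalEquality using (_≡_)
open import Function.Definitions using (Injective)
open import Function.Bundles using (_⇔_)
open import Data.Nat using (_≟_)

record Graph (n : ℕ) : Set where
  field
    adj       : Fin n → Fin n → Bool
    adj-sym   : ∀ x y → adj x y ≡ adj y x
    adj-irrefl : ∀ x → adj x x ≡ false

open Graph public

Adj : ∀ {n} → Graph n → Fin n → Fin n → Set
Adj G x y = T (adj G x y)

degree : ∀ {n} → Graph n → Fin n → ℕ
degree G x = ∣ tabulate (adj G x) ∣

Rel : ℕ → Set₁
Rel n = Fin n → Fin n → Set

data Walk {n} (E : Rel n) (U : Subset n) : Fin n → Fin n → Set where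
  here : ∀ {x} → x ∈ U → Walk E U x x
  step : ∀ {x y z} → x ∈ U → E x y → Walk E U y z → Walk E U x z

Disconnected : ∀ {n} → Rel n → Subset n → Set
Disconnected E U = ∃[ x ] ∃[ y ] (x ∈ U × y ∈ U × ¬ Walk E U x y)

KConnected : ∀ {n} → Rel n → Subset n → ℕ → Set
KConnected {n} E W k =
  k < ∣ W ∣ × (∀ (R : Subset n) → R ⊆ W → ∣ R ∣ < k → ¬ Disconnected E (W ∩ ∁ R))

module _ {n : ℕ} (G : Graph n) where

  Biconnected : Set
  Biconnected = KConnected (Adj G) ⊤ 2

  Critical : Set
  Critical = Biconnected × 4 ≤ n × (∀ (x : Fin n) → ¬ KConnected (Adj G) (∁ ⁅ x ⁆) 2)

  SameComp : Subset n → Fin n → Fin n → Set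
  SameComp R x y = Walk (Adj G) (∁ R) x y

  Cutset : Subset n → Set
  Cutset R = Disconnected (Adj G) (∁ R)

  Cutset2 : Subset n → Set
  Cutset2 R = ∣ R ∣ ≡ 2 × Cutset R

  Separates : Subset n → Subset n → Subset n → Set
  Separates R X Y =
    (∃[ x ] (x ∈ X × x ∉ R)) × (∃[ y ] (y ∈ Y × y ∉ R)) ×
    (∀ x y → x ∈ X → x ∉ R → y ∈ Y → y ∉ R → ¬ SameComp R x y)

  Splits : Subset n → Subset n → Set
  Splits R X = ∃[ x ] ∃[ y ] (x ∈ X × x ∉ R × y ∈ X × y ∉ R × ¬ SameComp R x y)

  Independent : Subset n → Subset n → Set
  Independent S T = ¬ Splits S T × ¬ Splits T S

  Single : Subset n → Set
  Single S = Cutset2 S × (∀ T → Cutset2 T → Independent S T)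

  Part : Subset n → Set
  Part A = (∀ S → Single S → ¬ Splits S A) ×
           (∀ v → v ∉ A → ∃[ S ] (Single S × Separates S ⁅ v ⁆ A))

  EmptyInterior : Subset n → Set
  EmptyInterior A = ∀ v → v ∈ A → ¬ (∀ S → Single S → v ∉ S)

  -- A is a terminal part and S is the (unique) single cutset adjacent to A in BT(G)
  TerminalWith : Subset n → Subset n → Set
  TerminalWith A S = Part A × Single S × S ⊆ A × (∀ T → Single T → T ⊆ A → T ≡ S)

  Adj' : Rel n
  Adj' a b = Adj G a b ⊎ Single (⁅ a ⁆ ∪ ⁅ b ⁆)

  IsBlock : Subset n → Set
  IsBlock A = KConnected Adj' A 3

  IsCycle : Subset n → Set
  IsCycle A =
    ∃[ m ] Σ (Fin (3 + m) → Fin n) λ f →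
      Injective _≡_ _≡_ f ×
      (∀ v → (v ∈ A) ⇔ (∃[ i ] (f i ≡ v))) ×
      (∀ i j → Adj' (f i) (f j) ⇔
         ((toℕ j ≡ suc (toℕ i) % (3 + m)) ⊎ (toℕ i ≡ suc (toℕ j) % (3 + m))))

  numDeg2 : ℕ
  numDeg2 = ∣ tabulate (λ x → ⌊ degree G x ≟ 2 ⌋) ∣

{-# OPTIONS --safe #-}
module Submission where

-- If a vertex x of a part A lies in no single cutset, all its neighbours lie in A, so a 2-vertex cutset
-- through x splits A.  Conversely, a cutset R separating x from another vertex of A is not single and is
-- crossed by some T; recombining vertices of R and T gives cutsets with ever smaller components at x, until
-- x is the only vertex of A in its component and x lies on a crossing cutset.  Hence as soon as one cutset
-- splits A, every vertex of A has exactly two neighbours in G'(A), and G'(A) is a cycle of length at least 4;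
-- if no cutset splits A, then G'(A) is triconnected or a triangle.  A single cutset S together with a
-- component of G − S that is minimal among all such components is a terminal part, and the two sides of any
-- single cutset each contain one such component.

open import Defs
open import Data.Nat using (ℕ; zero; suc; _+_; _∸_; _<_; _≤_; z≤n; s≤s)
open import Data.Nat.DivMod using (_%_; m<n⇒m%n≡m; n%n≡0; m%n<n)
import Data.Nat.Properties as ℕₚ
open import Data.Bool using (true; false; T)
open import Data.Bool.Properties using (T?; T-≡)
open import Data.Fin using (Fin; zero; suc; toℕ; fromℕ<)
open import Data.Fin.Properties using (_≟_; any?; pigeonhole; toℕ<n; toℕ-injective; toℕ-fromℕ<)
open import Data.Fin.Subset
  using (Subset; _∈_; _∉_; _⊆_; _⊂_; ∁; _∩_; _∪_; _-_; ⁅_⁆; ∣_∣; ⊤; ⊥; inside; outside)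
open import Data.Fin.Subset.Properties
open import Data.Vec using (tabulate; []; _∷_; there)
open import Data.Vec.Properties using (lookup∘tabulate; []=⇒lookup; lookup⇒[]=)
open import Data.Product using (∃-syntax; _×_; _,_; proj₁; proj₂)
open import Data.Sum using (_⊎_; inj₁; inj₂; swap)
open import Relation.Nullary using (¬_; Dec; yes; no; ⌊_⌋; contradiction)
open import Relation.Nullary.Decidable using (¬?; _×-dec_; _⊎-dec_; _→-dec_; map′; decidable-stable)
open import Relation.Binary.Definitions using (tri<; tri≈; tri>)
open import Relation.Unary using (Decidable)
open import Relation.Binary.PropositionalEquality
  using (_≡_; _≢_; refl; sym; trans; cong; subst; ≢-sym)
open import Function using (_∘_)
open import Function.Bundles using (_⇔_; mk⇔; Equivalence)

-- Walks inside a vertex set and deciding their existence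

private variable
  n : ℕ
  E E₁ : Rel n
  U U₁ : Subset n
  x y z : Fin n

Walk-mono : U ⊆ U₁ → Walk E U x y → Walk E U₁ x y
Walk-mono f (here x∈)     = here (f x∈)
Walk-mono f (step x∈ e w) = step (f x∈) e (Walk-mono f w)

Walk-start : Walk E U x y → x ∈ U
Walk-start (here x∈)     = x∈
Walk-start (step x∈ _ _) = x∈

Walk-end : Walk E U x y → y ∈ U
Walk-end (here x∈)    = x∈
Walk-end (step _ _ w) = Walk-end w

_++ʷ_ : Walk E U x y → Walk E U y z → Walk E U x z
here _      ++ʷ v = v
step x∈ e w ++ʷ v = step x∈ e (w ++ʷ v)

Walk-snoc : Walk E U x y → E y z → z ∈ U → Walk E U x z
Walk-snoc w e z∈ = w ++ʷ step (Walk-end w) e (here z∈)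

Walk-sym : (∀ {a b} → E a b → E b a) → Walk E U x y → Walk E U y x
Walk-sym s (here x∈)     = here x∈
Walk-sym s (step x∈ e w) = Walk-snoc (Walk-sym s w) (s e) x∈

-- Every vertex of the walk is reached from `x` by an initial segment of it.
Walk-transfer : Walk E U x y → (∀ z → Walk E U x z → z ∈ U₁) → Walk E U₁ x y
Walk-transfer (here x∈)     f = here (f _ (here x∈))
Walk-transfer (step x∈ e w) f = step (f _ (here x∈)) e (Walk-transfer w λ z v → f z (step x∈ e v))

-- Cut the walk at its first vertex `k` outside `P`: the segment before it stays in `P`, hence in
-- `U₁`.
exit : {P : Fin n → Set} → Decidable P → (∀ {w} → w ∈ U → P w → w ∈ U₁) →
  Walk E U x y → P x → ¬ P y →
  ∃[ h ] ∃[ k ] (P h × Walk E U₁ x h × E h k × k ∈ U × ¬ P k)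
exit P? f (here _) p ¬p = contradiction p ¬p
exit P? f (step {y = k} x∈ e w) p ¬p with P? k
... | no ¬pk = _ , k , p , here (f x∈ p) , e , Walk-start w , ¬pk
... | yes pk with exit P? f w pk ¬p
... | h , k , ph , v , e′ , k∈ , ¬pk = h , k , ph , step (f x∈ p) e v , e′ , k∈ , ¬pk

p-x⊆p : (U - x) ⊆ U
p-x⊆p {U = U} {x = x} = p─q⊆p U ⁅ x ⁆

x∉p-x : (p : Subset n) (x : Fin n) → x ∉ (p - x)
x∉p-x (_ ∷ p) zero    ()
x∉p-x (_ ∷ p) (suc x) (there m) = x∉p-x p x m

-- Cutting after the last visit to `v` leaves a tail in `U - v`; otherwise the walk ends at `v` or
-- never meets it.
lastVisit : (v : Fin n) → Walk E U x y → v ≡ y ⊎ Walk E (U - v) x y ⊎ ∃[ z ] (E v z × Walk E (U - v) z y)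
lastVisit {x = x} v (here x∈) with v ≟ x
... | yes v≡x = inj₁ v≡x
... | no v≢x  = inj₂ (inj₁ (here (x∈p∧x≢y⇒x∈p-y x∈ (≢-sym v≢x))))
lastVisit {x = x} v (step x∈ e w) with lastVisit v w
... | inj₁ v≡y        = inj₁ v≡y
... | inj₂ (inj₂ hit) = inj₂ (inj₂ hit)
... | inj₂ (inj₁ w′) with v ≟ x
...   | yes refl = inj₂ (inj₂ (_ , e , w′))
...   | no v≢x   = inj₂ (inj₁ (step (x∈p∧x≢y⇒x∈p-y x∈ (≢-sym v≢x)) e w′))

Walk-fromStart : Walk E U x y → x ≡ y ⊎ ∃[ z ] (E x z × Walk E (U - x) z y)
Walk-fromStart {U = U} {x = x} w with lastVisit x w
... | inj₁ eq       = inj₁ eq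
... | inj₂ (inj₁ v) = contradiction (Walk-start v) (x∉p-x U x)
... | inj₂ (inj₂ r) = inj₂ r

Decidable₂ : Rel n → Set
Decidable₂ E = ∀ x y → Dec (E x y)

-- Recursion on the size of `U`, bounded by `k`: a walk from `x` may be assumed never to return to
-- `x`, so after its first edge it lives in `U - x`.
walk? : Decidable₂ E → ∀ k (U : Subset n) → ∣ U ∣ ≤ k → ∀ x y → Dec (Walk E U x y)
walk? E? k U le x y with x ∈? U
... | no x∉ = no (x∉ ∘ Walk-start)
walk? {E = E} E? zero U le x y | yes x∈ = contradiction (ℕₚ.≤-trans (x∈p⇒∣p-x∣<∣p∣ x∈) le) λ ()
walk? {E = E} E? (suc k) U le x y | yes x∈ =
  map′ to Walk-fromStart (x ≟ y ⊎-dec any? λ z → E? x z ×-dec walk? E? k (U - x) le′ z y)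
  where
  le′ : ∣ U - x ∣ ≤ k
  le′ = ℕₚ.≤-pred (ℕₚ.≤-trans (x∈p⇒∣p-x∣<∣p∣ x∈) le)
  to : x ≡ y ⊎ ∃[ z ] (E x z × Walk E (U - x) z y) → Walk E U x y
  to (inj₁ refl)        = here x∈
  to (inj₂ (z , e , w)) = step x∈ e (Walk-mono p-x⊆p w)

abstract
  Walk? : Decidable₂ E → (U : Subset n) → ∀ x y → Dec (Walk E U x y)
  Walk? {n} E? U = walk? E? n U (∣p∣≤n U)

Disconnected? : Decidable₂ E → (U : Subset n) → Dec (Disconnected E U)
Disconnected? E? U = any? λ x → any? λ y → x ∈? U ×-dec y ∈? U ×-dec ¬? (Walk? E? U x y)

connected⇒Walk : Decidable₂ E → ¬ Disconnected E U → x ∈ U → y ∈ U → Walk E U x y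
connected⇒Walk {U = U} {x = x} {y = y} E? c x∈ y∈ =
  decidable-stable (Walk? E? U x y) λ ¬w → c (x , y , x∈ , y∈ , ¬w)

abstract
  someSubset? : {P : Subset n → Set} → Decidable P → Dec (∃[ p ] P p)
  someSubset? = anySubset?

  allSubset? : {P : Subset n → Set} → Decidable P → Dec (∀ p → P p)
  allSubset? P? with anySubset? (¬? ∘ P?)
  ... | yes (p , ¬Pp) = no λ f → ¬Pp (f p)
  ... | no ¬∃         = yes λ p → decidable-stable (P? p) λ ¬Pp → ¬∃ (p , ¬Pp)

-- Finite subsets

⟪_⟫ : {P : Fin n → Set} → Decidable P → Subset n
⟪ P? ⟫ = tabulate λ x → ⌊ P? x ⌋

∈⟪⟫⁺ : {P : Fin n → Set} (P? : Decidable P) → P x → x ∈ ⟪ P? ⟫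
∈⟪⟫⁺ {x = x} P? p = lookup⇒[]= x _ (trans (lookup∘tabulate _ x) (lemma (P? x)))
  where
  lemma : (d : Dec _) → ⌊ d ⌋ ≡ true
  lemma (yes _) = refl
  lemma (no ¬p) = contradiction p ¬p

∈⟪⟫⁻ : {P : Fin n → Set} (P? : Decidable P) → x ∈ ⟪ P? ⟫ → P x
∈⟪⟫⁻ {x = x} P? x∈ = lemma (P? x) (trans (sym (lookup∘tabulate _ x)) ([]=⇒lookup x∈))
  where
  lemma : (d : Dec _) → ⌊ d ⌋ ≡ true → _
  lemma (yes p) _ = p

pair : Fin n → Fin n → Subset n
pair a b = ⁅ a ⁆ ∪ ⁅ b ⁆

∈pairˡ : (a b : Fin n) → a ∈ pair a b
∈pairˡ a b = x∈p∪q⁺ (inj₁ (x∈⁅x⁆ a))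

∈pairʳ : (a b : Fin n) → b ∈ pair a b
∈pairʳ a b = x∈p∪q⁺ (inj₂ (x∈⁅x⁆ b))

∈pair⁻ : ∀ {a b} → x ∈ pair a b → x ≡ a ⊎ x ≡ b
∈pair⁻ {a = a} {b} x∈ with x∈p∪q⁻ ⁅ a ⁆ ⁅ b ⁆ x∈
... | inj₁ m = inj₁ (x∈⁅y⁆⇒x≡y a m)
... | inj₂ m = inj₂ (x∈⁅y⁆⇒x≡y b m)

∉pair : ∀ {a b} → x ≢ a → x ≢ b → x ∉ pair a b
∉pair x≢a x≢b x∈ with ∈pair⁻ x∈
... | inj₁ eq = x≢a eq
... | inj₂ eq = x≢b eq

pair⊆ : ∀ {a b} → a ∈ U → b ∈ U → pair a b ⊆ U
pair⊆ a∈ b∈ v∈ with ∈pair⁻ v∈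
... | inj₁ refl = a∈
... | inj₂ refl = b∈

pair-comm : (a b : Fin n) → pair a b ≡ pair b a
pair-comm a b = ∪-comm ⁅ a ⁆ ⁅ b ⁆

∣p∣≡0⇒p≡⊥ : (p : Subset n) → ∣ p ∣ ≡ 0 → p ≡ ⊥
∣p∣≡0⇒p≡⊥ []            _  = refl
∣p∣≡0⇒p≡⊥ (outside ∷ p) eq = cong (outside ∷_) (∣p∣≡0⇒p≡⊥ p eq)

∣p∣≡1⇒singleton : (p : Subset n) → ∣ p ∣ ≡ 1 → ∃[ a ] p ≡ ⁅ a ⁆
∣p∣≡1⇒singleton (inside ∷ p)  eq = zero , cong (inside ∷_) (∣p∣≡0⇒p≡⊥ p (ℕₚ.suc-injective eq))
∣p∣≡1⇒singleton (outside ∷ p) eq with ∣p∣≡1⇒singleton p eq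
... | a , p≡ = suc a , cong (outside ∷_) p≡

∣p∣≡2⇒pair : (p : Subset n) → ∣ p ∣ ≡ 2 → ∃[ a ] ∃[ b ] (a ≢ b × p ≡ pair a b)
∣p∣≡2⇒pair (inside ∷ p) eq with ∣p∣≡1⇒singleton p (ℕₚ.suc-injective eq)
... | b , refl = zero , suc b , (λ ()) , cong (inside ∷_) (sym (∪-identityˡ _))
∣p∣≡2⇒pair (outside ∷ p) eq with ∣p∣≡2⇒pair p eq
... | a , b , a≢b , refl = suc a , suc b , (λ { refl → a≢b refl }) , refl

∣pair∣≡2 : (a b : Fin n) → a ≢ b → ∣ pair a b ∣ ≡ 2
∣pair∣≡2 zero    zero    a≢b = contradiction refl a≢b
∣pair∣≡2 zero    (suc b) _   = cong suc (trans (cong ∣_∣ (∪-identityˡ ⁅ b ⁆)) (∣⁅x⁆∣≡1 b))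
∣pair∣≡2 (suc a) zero    _   = cong suc (trans (cong ∣_∣ (∪-identityʳ ⁅ a ⁆)) (∣⁅x⁆∣≡1 a))
∣pair∣≡2 (suc a) (suc b) a≢b = ∣pair∣≡2 a b (a≢b ∘ cong suc)

pair-unique : ∀ {a b} (p : Subset n) → ∣ p ∣ ≡ 2 → a ≢ b → a ∈ p → b ∈ p → p ≡ pair a b
pair-unique p eq a≢b a∈ b∈ with ∣p∣≡2⇒pair p eq
... | c , d , _ , refl with ∈pair⁻ a∈ | ∈pair⁻ b∈
... | inj₁ refl | inj₁ refl = contradiction refl a≢b
... | inj₁ refl | inj₂ refl = refl
... | inj₂ refl | inj₁ refl = pair-comm _ _
... | inj₂ refl | inj₂ refl = contradiction refl a≢b

∣p∣<∣q∣⇒∃ : (p q : Subset n) → ∣ p ∣ < ∣ q ∣ → ∃[ v ] (v ∈ q × v ∉ p)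
∣p∣<∣q∣⇒∃ p q lt with any? (λ v → v ∈? q ×-dec ¬? (v ∈? p))
... | yes r = r
... | no ¬r = contradiction lt (ℕₚ.≤⇒≯ (p⊆q⇒∣p∣≤∣q∣ λ {v} v∈q →
        decidable-stable (v ∈? p) λ v∉p → ¬r (v , v∈q , v∉p)))

∣p∪q∣≤∣p∣+∣q∣ : (p q : Subset n) → ∣ p ∪ q ∣ ≤ ∣ p ∣ + ∣ q ∣
∣p∪q∣≤∣p∣+∣q∣ []            []            = z≤n
∣p∪q∣≤∣p∣+∣q∣ (outside ∷ p) (outside ∷ q) = ∣p∪q∣≤∣p∣+∣q∣ p q
∣p∪q∣≤∣p∣+∣q∣ (outside ∷ p) (inside ∷ q)  =
  ℕₚ.≤-trans (s≤s (∣p∪q∣≤∣p∣+∣q∣ p q)) (ℕₚ.≤-reflexive (sym (ℕₚ.+-suc ∣ p ∣ ∣ q ∣)))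
∣p∪q∣≤∣p∣+∣q∣ (inside ∷ p)  (outside ∷ q) = s≤s (∣p∪q∣≤∣p∣+∣q∣ p q)
∣p∪q∣≤∣p∣+∣q∣ (inside ∷ p)  (inside ∷ q)  =
  s≤s (ℕₚ.≤-trans (∣p∪q∣≤∣p∣+∣q∣ p q) (ℕₚ.+-monoʳ-≤ ∣ p ∣ (ℕₚ.n≤1+n ∣ q ∣)))

1+∣p-x∣≤∣p∣ : ∀ {k} → x ∈ U → k ≤ ∣ U - x ∣ → suc k ≤ ∣ U ∣
1+∣p-x∣≤∣p∣ x∈ le = ℕₚ.≤-trans (s≤s le) (x∈p⇒∣p-x∣<∣p∣ x∈)

3≤∣p∣ : ∀ {a b c} → a ∈ U → b ∈ U → c ∈ U → b ≢ a → c ≢ a → c ≢ b → 3 ≤ ∣ U ∣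
3≤∣p∣ a∈ b∈ c∈ b≢a c≢a c≢b =
  1+∣p-x∣≤∣p∣ a∈ (1+∣p-x∣≤∣p∣ (x∈p∧x≢y⇒x∈p-y b∈ b≢a)
    (1+∣p-x∣≤∣p∣ (x∈p∧x≢y⇒x∈p-y (x∈p∧x≢y⇒x∈p-y c∈ c≢a) c≢b) z≤n))

4≤∣p∣ : ∀ {a b c d} → a ∈ U → b ∈ U → c ∈ U → d ∈ U →
  b ≢ a → c ≢ a → d ≢ a → c ≢ b → d ≢ b → d ≢ c → 4 ≤ ∣ U ∣
4≤∣p∣ a∈ b∈ c∈ d∈ b≢a c≢a d≢a c≢b d≢b d≢c =
  1+∣p-x∣≤∣p∣ a∈ (3≤∣p∣ (x∈p∧x≢y⇒x∈p-y b∈ b≢a) (x∈p∧x≢y⇒x∈p-y c∈ c≢a) (x∈p∧x≢y⇒x∈p-y d∈ d≢a)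
    c≢b d≢b d≢c)

-- Cutsets, components of their complements, and the edges of `G'`

module Cuts (G : Graph n) where

  private
    V = Fin n

    variable
      a b c d h k p q u v w x₁ x₂ : Fin n
      A R S T′ : Subset n

  adj? : Decidable₂ (Adj G)
  adj? x y = T? (adj G x y)

  Adj-sym : Adj G a b → Adj G b a
  Adj-sym {a} {b} = subst T (adj-sym G a b)

  Adj-irrefl : ¬ Adj G a a
  Adj-irrefl {a} e with adj G a a | adj-irrefl G a
  Adj-irrefl () | false | _

  Conn : Subset n → V → V → Set
  Conn = SameComp G

  conn? : ∀ R → Decidable₂ (Conn R)
  conn? R = Walk? adj? (∁ R)

  conn-refl : a ∉ R → Conn R a a
  conn-refl a∉ = here (x∉p⇒x∈∁p a∉)

  conn-sym : Conn R a b → Conn R b a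
  conn-sym = Walk-sym Adj-sym

  conn-edge : Adj G a b → a ∉ R → b ∉ R → Conn R a b
  conn-edge e a∉ b∉ = step (x∉p⇒x∈∁p a∉) e (conn-refl b∉)

  conn-∉ˡ : Conn R a b → a ∉ R
  conn-∉ˡ = x∈∁p⇒x∉p ∘ Walk-start

  conn-∉ʳ : Conn R a b → b ∉ R
  conn-∉ʳ = x∈∁p⇒x∉p ∘ Walk-end

  cutset2? : Decidable (Cutset2 G)
  cutset2? R = ∣ R ∣ ℕₚ.≟ 2 ×-dec Disconnected? adj? (∁ R)

  splits? : ∀ S X → Dec (Splits G S X)
  splits? S X = any? λ x → any? λ y →
    x ∈? X ×-dec ¬? (x ∈? S) ×-dec y ∈? X ×-dec ¬? (y ∈? S) ×-dec ¬? (conn? S x y)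

  single? : Decidable (Single G)
  single? S = cutset2? S ×-dec
    allSubset? λ T → cutset2? T →-dec (¬? (splits? S T) ×-dec ¬? (splits? T S))

  Adj′-sym : Adj' G a b → Adj' G b a
  Adj′-sym (inj₁ e)         = inj₁ (Adj-sym e)
  Adj′-sym {a} {b} (inj₂ s) = inj₂ (subst (Single G) (pair-comm a b) s)

  Adj′-irrefl : ¬ Adj' G a a
  Adj′-irrefl (inj₁ e)                   = Adj-irrefl e
  Adj′-irrefl {a} (inj₂ ((eq , _) , _)) with trans (sym eq) (trans (cong ∣_∣ (∪-idem ⁅ a ⁆)) (∣⁅x⁆∣≡1 a))
  ... | ()

  comp : Subset n → V → Subset n
  comp R x = ⟪ conn? R x ⟫

  -- The first vertex off the component of `x` is adjacent to that component, so it would belong to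
  -- it if it were not in `R`.
  exitComp : (∀ {w} → w ∈ U → Conn R x w → w ∈ U₁) → Walk (Adj G) U w z → Conn R x w → ¬ Conn R x z →
    ∃[ h ] ∃[ k ] (Conn R x h × Walk (Adj G) U₁ w h × Adj G h k × k ∈ U × k ∈ R)
  exitComp {R = R} {x = x} f wk xw ¬xz with exit (conn? R x) f wk xw ¬xz
  ... | h , k , xh , wh , hk , k∈U , ¬xk = h , k , xh , wh , hk , k∈U ,
    decidable-stable (k ∈? R) λ k∉ → ¬xk (Walk-snoc xh hk (x∉p⇒x∈∁p k∉))

  splitsOf : ¬ Conn R a b → a ∈ A → a ∉ R → b ∈ A → b ∉ R → Splits G R A
  splitsOf ¬c a∈ a∉ b∈ b∉ = _ , _ , a∈ , a∉ , b∈ , b∉ , ¬c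

  unsplit : ¬ Splits G R A → a ∈ A → a ∉ R → b ∈ A → b ∉ R → Conn R a b
  unsplit {R = R} {a = a} {b = b} ¬s a∈ a∉ b∈ b∉ =
    decidable-stable (conn? R a b) λ ¬c → ¬s (splitsOf ¬c a∈ a∉ b∈ b∉)

  mkCutset2 : ∣ R ∣ ≡ 2 → a ∉ R → b ∉ R → ¬ Conn R a b → Cutset2 G R
  mkCutset2 eq a∉ b∉ ¬c = eq , _ , _ , x∉p⇒x∈∁p a∉ , x∉p⇒x∈∁p b∉ , ¬c

  cutset2-split : Cutset2 G R → ∃[ a ] ∃[ b ] (a ∉ R × b ∉ R × ¬ Conn R a b)
  cutset2-split (_ , a , b , a∈ , b∈ , ¬c) = a , b , x∈∁p⇒x∉p a∈ , x∈∁p⇒x∉p b∈ , ¬c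

  -- An added edge joins the two vertices of a single cutset, and by independence `R` does not split
  -- that pair.
  conn-Adj′ : Cutset2 G R → Adj' G a b → a ∉ R → b ∉ R → Conn R a b
  conn-Adj′ cut (inj₁ e) a∉ b∉ = conn-edge e a∉ b∉
  conn-Adj′ {R} {a} {b} cut (inj₂ (_ , ind)) a∉ b∉ =
    unsplit (proj₂ (ind R cut)) (∈pairˡ a b) a∉ (∈pairʳ a b) b∉

  conn-Walk′ : Cutset2 G R → Walk (Adj' G) (A ∩ ∁ R) a b → Conn R a b
  conn-Walk′ {R} {A} cut (here a∈) = here (proj₂ (x∈p∩q⁻ A (∁ R) a∈))
  conn-Walk′ {R} {A} cut (step a∈ e w) =
    conn-Adj′ cut e (x∈∁p⇒x∉p (proj₂ (x∈p∩q⁻ A (∁ R) a∈))) (conn-∉ˡ rest) ++ʷ rest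
    where rest = conn-Walk′ cut w

  -- Connected 2-regular graphs are cycles

  record TwoNbrs (A : Subset n) (x : V) : Set where
    field
      {l r} : V
      l≢r   : l ≢ r
      l∈    : l ∈ A
      r∈    : r ∈ A
      xl    : Adj' G x l
      xr    : Adj' G x r
      only  : ∀ {z} → z ∈ A → Adj' G x z → z ≡ l ⊎ z ≡ r

  -- In a connected 2-regular graph, walk on without turning back; the first repeated vertex is the start.
  module Cycle (A : Subset n) (nbrs : ∀ {x} → x ∈ A → TwoNbrs A x)
    (linked : ∀ {x y} → x ∈ A → y ∈ A → Walk (Adj' G) A x y) (x₀ : V) (x₀∈ : x₀ ∈ A) where

    -- A directed edge is the state of the walk: the previous vertex must be remembered in order not
    -- to turn back.
    record Arc : Set where
      constructor arc
      field
        {prev cur} : V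
        prev∈      : prev ∈ A
        cur∈       : cur ∈ A
        edge       : Adj' G prev cur
    open Arc

    abstract
      onward : (e : Arc) → ∃[ c ] (c ∈ A × Adj' G (cur e) c × c ≢ prev e ×
        (∀ {z} → z ∈ A → Adj' G (cur e) z → z ≡ prev e ⊎ z ≡ c))
      onward (arc p∈ c∈ e) with nbrs c∈
      ... | N with TwoNbrs.only N p∈ (Adj′-sym e)
      ...   | inj₁ refl = r , r∈ , xr , ≢-sym l≢r , only where open TwoNbrs N
      ...   | inj₂ refl = l , l∈ , xl , l≢r , λ z∈ xz → swap (only z∈ xz) where open TwoNbrs N

    next : Arc → Arc
    next e = arc (cur∈ e) (proj₁ (proj₂ (onward e))) (proj₁ (proj₂ (proj₂ (onward e))))

    arcs : ℕ → Arc
    arcs zero    = arc x₀∈ (TwoNbrs.l∈ (nbrs x₀∈)) (TwoNbrs.xl (nbrs x₀∈))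
    arcs (suc i) = next (arcs i)

    f : ℕ → V
    f i = prev (arcs i)

    f∈ : ∀ i → f i ∈ A
    f∈ i = prev∈ (arcs i)

    f-edge : ∀ i → Adj' G (f i) (f (suc i))
    f-edge i = edge (arcs i)

    f-≢ : ∀ i → f (2 + i) ≢ f i
    f-≢ i = proj₁ (proj₂ (proj₂ (proj₂ (onward (arcs i)))))

    f-nbr : ∀ i {z} → z ∈ A → Adj' G (f (suc i)) z → z ≡ f i ⊎ z ≡ f (2 + i)
    f-nbr i = proj₂ (proj₂ (proj₂ (proj₂ (onward (arcs i)))))

    Repeat : ℕ → Set
    Repeat j = ∃[ i ] (i < j × f i ≡ f j)

    repeat? : Decidable Repeat
    repeat? j = ℕₚ.anyUpTo? (λ i → f i ≟ f j) j

    firstRepeat : ∀ k → (∃[ j ] (Repeat j × (∀ {i} → i < j → ¬ Repeat i))) ⊎ (∀ {i} → i < k → ¬ Repeat i)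
    firstRepeat zero = inj₂ λ ()
    firstRepeat (suc k) with firstRepeat k
    ... | inj₁ found = inj₁ found
    ... | inj₂ none with repeat? k
    ...   | yes rep = inj₁ (k , rep , none)
    ...   | no ¬rep = inj₂ λ {i} i<1+k → case-≤ (ℕₚ.m<1+n⇒m<n∨m≡n i<1+k)
      where
      case-≤ : ∀ {i} → i < k ⊎ i ≡ k → ¬ Repeat i
      case-≤ (inj₁ i<k)  = none i<k
      case-≤ (inj₂ refl) = ¬rep

    first : ∃[ j ] (Repeat j × (∀ {i} → i < j → ¬ Repeat i))
    first with firstRepeat (suc n)
    ... | inj₁ found = found
    -- Two of the `n + 1` vertices `f 0`, ..., `f n` agree.
    ... | inj₂ none with pigeonhole ℕₚ.≤-refl (f ∘ toℕ)
    ...   | i , j , i<j , eq = contradiction (toℕ i , i<j , eq) (none (toℕ<n j))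

    module Closed (m : ℕ) (closes : f 0 ≡ f (3 + m)) (fresh : ∀ {i} → i < 3 + m → ¬ Repeat i) where

      N : ℕ
      N = 3 + m

      f-inj : ∀ {i j} → i < N → j < N → f i ≡ f j → i ≡ j
      f-inj {i} {j} i< j< eq with ℕₚ.<-cmp i j
      ... | tri< i<j _ _ = contradiction (i , i<j , eq) (fresh j<)
      ... | tri≈ _ i≡j _ = i≡j
      ... | tri> _ _ j<i = contradiction (j , j<i , sym eq) (fresh i<)

      succ : ∀ {i} → i < N → (suc i < N × suc i % N ≡ suc i) ⊎ (suc i ≡ N × suc i % N ≡ 0)
      succ {i} i< with ℕₚ.m≤n⇒m<n∨m≡n i<
      ... | inj₁ lt   = inj₁ (lt , m<n⇒m%n≡m lt)
      ... | inj₂ refl = inj₂ (refl , n%n≡0 N)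

      f-suc : ∀ {i} → i < N → f (suc i % N) ≡ f (suc i)
      f-suc i< with succ i<
      ... | inj₁ (_ , eq)     = cong f eq
      ... | inj₂ (refl , eq) = trans (cong f eq) closes

      -- `f 1` is a neighbour of `f N`, which is `f 0`, so it is `f (2 + m)` or `f (suc N)`; the
      -- former would be a repeat before `N`.
      f-1 : f 1 ≡ f (suc N)
      f-1 with f-nbr (2 + m) (f∈ 1) (subst (λ v → Adj' G v (f 1)) closes (f-edge 0))
      ... | inj₂ eq = eq
      ... | inj₁ eq with f-inj {1} {2 + m} (s≤s (s≤s z≤n)) ℕₚ.≤-refl eq
      ...   | ()

      f-nbrs : ∀ {i z} → i < N → z ∈ A → Adj' G (f i) z →
        z ≡ f (suc i % N) ⊎ ∃[ j ] (j < N × z ≡ f j × i ≡ suc j % N)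
      f-nbrs {suc i} i< z∈ e with f-nbr i z∈ e
      ... | inj₁ eq = inj₂ (i , ℕₚ.<-trans (ℕₚ.n<1+n i) i< , eq , sym (m<n⇒m%n≡m i<))
      ... | inj₂ eq = inj₁ (trans eq (sym (f-suc i<)))
      f-nbrs {zero} {z} i< z∈ e with f-nbr (2 + m) z∈ (subst (λ v → Adj' G v z) closes e)
      ... | inj₁ eq = inj₂ (2 + m , ℕₚ.≤-refl , eq , sym (n%n≡0 N))
      ... | inj₂ eq = inj₁ (trans eq (sym f-1))

      -- The listed vertices are closed under adjacency in `G'(A)`, so a walk from `f 0` to an
      -- unlisted vertex has no edge on which to leave them.
      covers : ∀ {v} → v ∈ A → ∃[ i ] (i < N × f i ≡ v)
      covers {v} v∈ with ℕₚ.anyUpTo? (λ i → f i ≟ v) N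
      ... | yes r = r
      ... | no ¬r with exit {U₁ = A} (λ w → ℕₚ.anyUpTo? (λ i → f i ≟ w) N) (λ w∈ _ → w∈)
                        (linked (f∈ 0) v∈) (0 , s≤s z≤n , refl) ¬r
      ... | _ , k , (i , i< , refl) , _ , hk , k∈ , ¬k with f-nbrs i< k∈ hk
      ...   | inj₁ eq                = contradiction (suc i % N , m%n<n (suc i) N , sym eq) ¬k
      ...   | inj₂ (j , j< , eq , _) = contradiction (j , j< , sym eq) ¬k

      isCycle : IsCycle G A
      isCycle = m , f ∘ toℕ , (λ {i} {j} eq → toℕ-injective (f-inj (toℕ<n i) (toℕ<n j) eq)) ,
        (λ v → mk⇔ (onto v) λ { (i , refl) → f∈ (toℕ i) }) , λ i j → mk⇔ (to i j) (from i j)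
        where
        onto : ∀ v → v ∈ A → ∃[ i ] (f (toℕ i) ≡ v)
        onto v v∈ with covers v∈
        ... | i , i< , eq = fromℕ< i< , trans (cong f (toℕ-fromℕ< i<)) eq
        to : ∀ (i j : Fin N) → Adj' G (f (toℕ i)) (f (toℕ j)) →
          toℕ j ≡ suc (toℕ i) % N ⊎ toℕ i ≡ suc (toℕ j) % N
        to i j e with f-nbrs (toℕ<n i) (f∈ (toℕ j)) e
        ... | inj₁ eq = inj₁ (f-inj (toℕ<n j) (m%n<n (suc (toℕ i)) N) eq)
        ... | inj₂ (k , k< , eq , i≡) with f-inj (toℕ<n j) k< eq
        ...   | refl = inj₂ i≡
        from : ∀ (i j : Fin N) → toℕ j ≡ suc (toℕ i) % N ⊎ toℕ i ≡ suc (toℕ j) % N →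
          Adj' G (f (toℕ i)) (f (toℕ j))
        from i j (inj₁ eq) = subst (Adj' G (f (toℕ i))) (sym (trans (cong f eq) (f-suc (toℕ<n i)))) (f-edge (toℕ i))
        from i j (inj₂ eq) = Adj′-sym
          (subst (Adj' G (f (toℕ j))) (sym (trans (cong f eq) (f-suc (toℕ<n j)))) (f-edge (toℕ j)))

    -- If the first repeat were of `f (suc i)`, then `f N`, being adjacent to it, would equal `f i`
    -- or `f (2 + i)`: an earlier repeat, unless `N` is `2 + i` or `1 + i`, when the walk turns back
    -- or uses a loop. So the first repeat is of `f 0`, and by the same two obstructions it occurs
    -- at index 3 or later.
    isCycle : IsCycle G A
    isCycle with first
    ... | suc N , (suc i , s≤s i<N , eq) , fresh with f-nbr i (f∈ N)
                 (Adj′-sym (subst (Adj' G (f N)) (sym eq) (f-edge N)))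
    ...   | inj₁ N≡i = contradiction (i , i<N , sym N≡i) (fresh ℕₚ.≤-refl)
    ...   | inj₂ N≡2+i with ℕₚ.<-cmp (2 + i) N
    ...     | tri< 2+i<N _ _ = contradiction (2 + i , 2+i<N , sym N≡2+i) (fresh ℕₚ.≤-refl)
    ...     | tri≈ _ refl _  = contradiction (sym eq) (f-≢ (suc i))
    ...     | tri> _ _ N<2+i with ℕₚ.≤-antisym i<N (ℕₚ.≤-pred N<2+i)
    ...       | refl = contradiction (subst (Adj' G (f (suc i))) (sym eq) (f-edge (suc i))) Adj′-irrefl
    isCycle | suc zero , (zero , _ , eq) , _ = contradiction (subst (Adj' G (f 0)) (sym eq) (f-edge 0)) Adj′-irrefl
    isCycle | suc (suc zero) , (zero , _ , eq) , _ = contradiction (sym eq) (f-≢ 0)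
    isCycle | suc (suc (suc m)) , (zero , _ , eq) , fresh = Closed.isCycle m eq fresh

  -- Crossing 2-vertex cutsets in a biconnected graph

  module Biconn (bic : Biconnected G) where

    connected₁ : ∣ R ∣ < 2 → a ∉ R → b ∉ R → Conn R a b
    connected₁ {R} lt a∉ b∉ =
      Walk-mono (λ m → proj₂ (x∈p∩q⁻ ⊤ (∁ R) m))
        (connected⇒Walk adj? (proj₂ bic R ⊆⊤ lt) (member a∉) (member b∉))
      where
      member : x₁ ∉ R → x₁ ∈ ⊤ ∩ ∁ R
      member x∉ = x∈p∩q⁺ (∈⊤ , x∉p⇒x∈∁p x∉)

    connected-⁅⁆ : a ≢ c → b ≢ c → Conn ⁅ c ⁆ a b
    connected-⁅⁆ {c = c} a≢c b≢c =
      connected₁ (subst (_< 2) (sym (∣⁅x⁆∣≡1 c)) ℕₚ.≤-refl) (x≢y⇒x∉⁅y⁆ a≢c) (x≢y⇒x∉⁅y⁆ b≢c)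

    -- In `G − b` a walk leads from `x₁` to `a`; it can leave the component of `x₁` only through
    -- `a`. So each component borders on both cut vertices.
    attach : a ≢ b → x₁ ∉ pair a b → ∃[ h ] (Conn (pair a b) x₁ h × Adj G h a)
    attach {a} {b} a≢b x∉
      with exitComp {U₁ = ⊤} (λ _ _ → ∈⊤) (connected-⁅⁆ (λ { refl → x∉ (∈pairʳ a b) }) a≢b)
             (conn-refl x∉) (λ c → conn-∉ʳ c (∈pairˡ a b))
    ... | h , k , x~h , _ , hk , k∈ , k∈R with ∈pair⁻ k∈R
    ...   | inj₁ refl = h , x~h , hk
    ...   | inj₂ refl = contradiction (x∈⁅x⁆ b) (x∈∁p⇒x∉p k∈)

    conn-transfer : (∀ {w} → Conn R x₁ w → w ∉ S) → Conn R x₁ v → Conn S x₁ v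
    conn-transfer disj c = Walk-transfer c λ _ → x∉p⇒x∈∁p ∘ disj

    bridge-pair : a ≢ b → x₁ ∉ pair a b → (∀ {w} → Conn (pair a b) x₁ w → w ∉ T′) → a ∉ T′ → Conn T′ x₁ a
    bridge-pair a≢b x∉ disj a∉T with attach a≢b x∉
    ... | h , x~h , ha = Walk-snoc (conn-transfer disj x~h) ha (x∉p⇒x∈∁p a∉T)

    -- A component of `G − R` that misses `T′` stays connected in `G − T′`, and by `attach` it
    -- borders on `a`.
    bridge : ∣ R ∣ ≡ 2 → x₁ ∉ R → (∀ {w} → Conn R x₁ w → w ∉ T′) → a ∈ R → a ∉ T′ → Conn T′ x₁ a
    bridge {R} eq x∉ disj a∈ a∉ with ∣p∣≡2⇒pair R eq
    ... | c , d , c≢d , refl with ∈pair⁻ a∈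
    ...   | inj₁ refl = bridge-pair c≢d x∉ disj a∉
    ...   | inj₂ refl rewrite pair-comm c d = bridge-pair (≢-sym c≢d) x∉ disj a∉

    -- A component of `G − R` missing `T′` would join any two vertices of `R` outside `T′`, by
    -- `bridge`.
    split-meets : ∣ R ∣ ≡ 2 → Splits G T′ R → x₁ ∉ R → ∃[ t ] (t ∈ T′ × Conn R x₁ t)
    split-meets {R} {T′} {x₁} eq (a , b , a∈ , a∉ , b∈ , b∉ , ¬ab) x∉
      with any? (λ t → t ∈? T′ ×-dec conn? R x₁ t)
    ... | yes r = r
    ... | no ¬r = contradiction (conn-sym (bridge eq x∉ disj a∈ a∉) ++ʷ bridge eq x∉ disj b∈ b∉) ¬ab
      where
      disj : Conn R x₁ w → w ∉ T′
      disj c w∈ = ¬r (_ , w∈ , c)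

    -- By `split-meets`, `T′` has vertices in two different components of `G − R`.
    splits-sym : Cutset2 G R → Splits G T′ R → Splits G R T′
    splits-sym cut sp with cutset2-split cut
    ... | x , y , x∉ , y∉ , ¬xy with split-meets (proj₁ cut) sp x∉ | split-meets (proj₁ cut) sp y∉
    ...   | t₁ , t₁∈ , xt₁ | t₂ , t₂∈ , yt₂ =
      splitsOf (λ c → ¬xy (xt₁ ++ʷ (c ++ʷ conn-sym yt₂))) t₁∈ (conn-∉ʳ xt₁) t₂∈ (conn-∉ʳ yt₂)

    nonsingle-split : Cutset2 G R → ¬ Single G R → ∃[ T ] (Cutset2 G T × Splits G T R)
    nonsingle-split {R} cut ¬single with someSubset? (λ T → cutset2? T ×-dec splits? T R)
    ... | yes r = r
    ... | no ¬r = contradiction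
      (cut , λ T cutT → (λ sp → ¬r (T , cutT , splits-sym cutT sp)) , λ sp → ¬r (T , cutT , sp)) ¬single

    -- {p , q} and {a , b} split each other, and p lies in the component of x in G − {a , b}.
    record Crossed (x a b p q : V) : Set where
      field
        a≢b : a ≢ b
        a∉T : a ∉ pair p q
        b∉T : b ∉ pair p q
        ¬ab : ¬ Conn (pair p q) a b
        x~p : Conn (pair a b) x p
        x≁q : ¬ Conn (pair a b) x q
        q∉R : q ∉ pair a b

    crossed-swap : Crossed x₁ a b p q → Crossed x₁ b a p q
    crossed-swap {x₁} {a} {b} {p} {q} cr = record
      { a≢b = ≢-sym a≢b
      ; a∉T = b∉T
      ; b∉T = a∉T
      ; ¬ab = ¬ab ∘ conn-sym
      ; x~p = subst (λ R → Conn R x₁ p) (pair-comm a b) x~p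
      ; x≁q = subst (λ R → ¬ Conn R x₁ q) (pair-comm a b) x≁q
      ; q∉R = subst (q ∉_) (pair-comm a b) q∉R
      }
      where open Crossed cr

    -- A cutset splitting `{a , b}` meets both components, at `p` beside `x₁` and at `q` beside
    -- `x₂`; having two vertices, it is `{p , q}`.
    crossed : Cutset2 G (pair a b) → ¬ Single G (pair a b) →
      x₁ ∉ pair a b → x₂ ∉ pair a b → ¬ Conn (pair a b) x₁ x₂ →
      ∃[ p ] ∃[ q ] (Cutset2 G (pair p q) × Crossed x₁ a b p q × Conn (pair a b) x₂ q)
    crossed {a} {b} {x₁} {x₂} cut ¬single x₁∉ x₂∉ ¬x₁x₂ with nonsingle-split cut ¬single
    ... | T′ , cutT , sp with split-meets (proj₁ cut) sp x₁∉ | split-meets (proj₁ cut) sp x₂∉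
    ... | p , p∈ , x~p | q , q∈ , y~q with p ≟ q
    ...   | yes refl = contradiction (x~p ++ʷ conn-sym y~q) ¬x₁x₂
    ...   | no p≢q with pair-unique T′ (proj₁ cutT) p≢q p∈ q∈
    ...     | refl = p , q , cutT , cr sp , y~q
      where
      x≁q : ¬ Conn (pair a b) x₁ q
      x≁q c = ¬x₁x₂ (c ++ʷ conn-sym y~q)
      cr : Splits G (pair p q) (pair a b) → Crossed x₁ a b p q
      cr (c , d , c∈ , c∉ , d∈ , d∉ , ¬cd) with ∈pair⁻ c∈ | ∈pair⁻ d∈
      ... | inj₁ refl | inj₁ refl = contradiction (conn-refl c∉) ¬cd
      ... | inj₂ refl | inj₂ refl = contradiction (conn-refl c∉) ¬cd
      ... | inj₁ refl | inj₂ refl = record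
        { a≢b = λ { refl → ¬cd (conn-refl c∉) } ; a∉T = c∉ ; b∉T = d∉ ; ¬ab = ¬cd
        ; x~p = x~p ; x≁q = x≁q ; q∉R = conn-∉ʳ y~q }
      ... | inj₂ refl | inj₁ refl = record
        { a≢b = λ { refl → ¬cd (conn-refl c∉) } ; a∉T = d∉ ; b∉T = c∉ ; ¬ab = ¬cd ∘ conn-sym
        ; x~p = x~p ; x≁q = x≁q ; q∉R = conn-∉ʳ y~q }

    -- Walk from `w` to `a` in `G − p`. Until it leaves the component of `x₁` it avoids `q` too,
    -- since `q` lies outside that component; it leaves at `a` or `b`.
    side : Crossed x₁ a b p q → Conn (pair a b) x₁ w → w ≢ p →
      Conn (pair p q) w a ⊎ Conn (pair p q) w b
    side {x₁} {a} {b} {p} {q} {w} cr x~w w≢p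
      with exitComp {U₁ = ∁ (pair p q)} inside-T
             (connected-⁅⁆ w≢p λ { refl → a∉T (∈pairˡ p q) }) x~w (λ c → conn-∉ʳ c (∈pairˡ a b))
      where
      open Crossed cr
      inside-T : ∀ {v} → v ∈ ∁ ⁅ p ⁆ → Conn (pair a b) x₁ v → v ∈ ∁ (pair p q)
      inside-T v∈ c = x∉p⇒x∈∁p (∉pair (x∉⁅y⁆⇒x≢y (x∈∁p⇒x∉p v∈)) λ { refl → x≁q c })
    ... | h , k , _ , wh , hk , _ , k∈R with ∈pair⁻ k∈R
    ...   | inj₁ refl = inj₁ (Walk-snoc wh hk (x∉p⇒x∈∁p (Crossed.a∉T cr)))
    ...   | inj₂ refl = inj₂ (Walk-snoc wh hk (x∉p⇒x∈∁p (Crossed.b∉T cr)))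

    -- With `a` deleted, the component of `x₁` can be left only through `b`. Up to then the walk
    -- avoids `p`, which is deleted, and `q`, which lies outside, so it would join the side of `a`
    -- to `b` in `G − {p , q}`.
    confine : Crossed x₁ a b p q → Conn (pair a b) x₁ w → Conn (pair p q) w a →
      Conn (pair a p) w v → Conn (pair a b) x₁ v
    confine {x₁} {a} {b} {p} {q} {w} {v} cr x~w w~a w~v =
      decidable-stable (conn? (pair a b) x₁ v) outside-absurd
      where
      open Crossed cr
      inside-T : ∀ {v} → v ∈ ∁ (pair a p) → Conn (pair a b) x₁ v → v ∈ ∁ (pair p q)
      inside-T v∈ c = x∉p⇒x∈∁p (∉pair (λ { refl → x∈∁p⇒x∉p v∈ (∈pairʳ a p) }) λ { refl → x≁q c })
      outside-absurd : ¬ ¬ Conn (pair a b) x₁ v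
      outside-absurd ¬x~v with exitComp {U₁ = ∁ (pair p q)} inside-T w~v x~w ¬x~v
      ... | h , k , _ , wh , hk , k∈ , k∈R with ∈pair⁻ k∈R
      ...   | inj₁ refl = x∈∁p⇒x∉p k∈ (∈pairˡ a p)
      ...   | inj₂ refl = ¬ab (conn-sym w~a ++ʷ Walk-snoc wh hk (x∉p⇒x∈∁p b∉T))

    -- Parts, their interiors, and walks in `G'(A)`

    Interior : V → Set
    Interior v = ∀ S → Single G S → v ∉ S

    Sep : Subset n → V → Subset n → Set
    Sep S u A = u ∉ S × (∃[ y ] (y ∈ A × y ∉ S)) × (∀ {y} → y ∈ A → y ∉ S → ¬ Conn S u y)

    separates⇒Sep : Separates G S ⁅ u ⁆ A → Sep S u A
    separates⇒Sep {u = u} ((x , x∈ , x∉) , ne , sep) with x∈⁅y⁆⇒x≡y u x∈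
    ... | refl = x∉ , ne , λ y∈ y∉ → sep u _ x∈ x∉ y∈ y∉

    Sep⇒separates : Sep S u A → Separates G S ⁅ u ⁆ A
    Sep⇒separates {S} {u} {A} (u∉ , ne , sep) = (u , x∈⁅x⁆ u , u∉) , ne , sep′
      where
      sep′ : ∀ x y → x ∈ ⁅ u ⁆ → x ∉ S → y ∈ A → y ∉ S → ¬ Conn S x y
      sep′ x y x∈ _ y∈ y∉ with x∈⁅y⁆⇒x≡y u x∈
      ... | refl = sep y∈ y∉

    part-sep : Part G A → u ∉ A → ∃[ S ] (Single G S × Sep S u A)
    part-sep part u∉ with proj₂ part _ u∉
    ... | S , single , sep = S , single , separates⇒Sep sep

    -- A single cutset separating `u` from `A` would miss `v` and thus be defeated by the edge `vu`.
    interior-nbr : Part G A → v ∈ A → Interior v → Adj G v u → u ∈ A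
    interior-nbr {A} {v} {u} part v∈ int e = decidable-stable (u ∈? A) λ u∉ →
      let S , single , u∉S , _ , sep = part-sep part u∉ in
      sep v∈ (int S single) (conn-edge (Adj-sym e) u∉S (int S single))

    -- A single cutset separating u from A with the largest possible component of u lies inside A.
    maximal-sep : Part G A → ∀ k S → n ≤ k + ∣ comp S u ∣ → Single G S → Sep S u A →
      ∃[ S′ ] (Single G S′ × S′ ⊆ A × Sep S′ u A)
    maximal-sep {A} {u} part k S le single sep@(u∉ , (y , y∈ , y∉) , ¬u~)
      with any? (λ s → s ∈? S ×-dec ¬? (s ∈? A))
    ... | no ¬r = S , single , (λ {s} s∈ → decidable-stable (s ∈? A) λ s∉ → ¬r (s , s∈ , s∉)) , sep
    ... | yes (s , s∈S , s∉A) with part-sep part s∉A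
    ... | S′ , single′ , s∉S′ , (y′ , y′∈ , y′∉) , ¬s~ with any? (λ t → t ∈? S′ ×-dec conn? S u t)
    -- `S` does not split `S′`, so `S′` misses the component of `y`. That component borders on `s`,
    -- so `S′` would fail to separate `s` from `A`.
    ... | yes (t , t∈ , u~t) = contradiction (conn-sym y~s) (¬s~ y∈ y∉S′)
      where
      disj : Conn S y v → v ∉ S′
      disj {v} y~v v∈ = ¬u~ y∈ y∉ (u~t ++ʷ (t~v ++ʷ conn-sym y~v))
        where
        t~v : Conn S t v
        t~v = unsplit (proj₁ (proj₂ single S′ (proj₁ single′))) t∈ (conn-∉ʳ u~t) v∈ (conn-∉ʳ y~v)
      y∉S′ : y ∉ S′
      y∉S′ = disj (conn-refl y∉)
      y~s : Conn S′ y s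
      y~s = bridge (proj₁ (proj₁ single)) y∉ disj s∈S s∉S′
    -- Now the component of `u` survives in `G − S′` and gains `s`, so `S′` also separates `u` from
    -- `A`; `k` bounds the number of such enlargements.
    ... | no ¬r = continue k le
      where
      disj : Conn S u v → v ∉ S′
      disj u~v v∈ = ¬r (_ , v∈ , u~v)
      u~s : Conn S′ u s
      u~s = bridge (proj₁ (proj₁ single)) u∉ disj s∈S s∉S′
      bigger : comp S u ⊂ comp S′ u
      bigger = (λ v∈ → ∈⟪⟫⁺ (conn? S′ u) (conn-transfer disj (∈⟪⟫⁻ (conn? S u) v∈)))
             , s , ∈⟪⟫⁺ (conn? S′ u) u~s , λ s∈ → conn-∉ʳ (∈⟪⟫⁻ (conn? S u) s∈) s∈S
      sep′ : Sep S′ u A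
      sep′ = disj (conn-refl u∉) , (y′ , y′∈ , y′∉) , λ w∈ w∉ u~w → ¬s~ w∈ w∉ (conn-sym u~s ++ʷ u~w)
      continue : ∀ k → n ≤ k + ∣ comp S u ∣ → ∃[ S″ ] (Single G S″ × S″ ⊆ A × Sep S″ u A)
      continue zero le = contradiction (ℕₚ.≤-trans (p⊂q⇒∣p∣<∣q∣ bigger) (∣p∣≤n (comp S′ u))) (ℕₚ.≤⇒≯ le)
      continue (suc k) le = maximal-sep part k S′
        (ℕₚ.≤-trans le (ℕₚ.≤-trans (ℕₚ.≤-reflexive (sym (ℕₚ.+-suc k _))) (ℕₚ.+-monoʳ-≤ k (p⊂q⇒∣p∣<∣q∣ bigger))))
        single′ sep′

    part-sep-inside : Part G A → u ∉ A → ∃[ S ] (Single G S × S ⊆ A × Sep S u A)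
    part-sep-inside part u∉ with part-sep part u∉
    ... | S , single , sep = maximal-sep part n S (ℕₚ.m≤m+n n _) single sep

    -- An excursion outside A leaves and re-enters through the two vertices of one single cutset.
    part-walk-in : Part G A → b ∈ A → Conn R a b → a ∈ A → Walk (Adj' G) (A ∩ ∁ R) a b
    part-walk-out : Part G A → b ∈ A → Conn R a b → a ∉ A →
      Single G S → S ⊆ A → Sep S a A → ∃[ c ] (c ∈ S × Walk (Adj' G) (A ∩ ∁ R) c b)
    part-walk-in part b∈ (here a∈) a∈A = here (x∈p∩q⁺ (a∈A , a∈))
    part-walk-in {A} part b∈ (step {x = a} {y = k} a∈ e w) a∈A with k ∈? A
    ... | yes k∈ = step (x∈p∩q⁺ (a∈A , a∈)) (inj₁ e) (part-walk-in part b∈ w k∈)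
    ... | no k∉ with part-sep-inside part k∉
    ... | S , single , S⊆A , sep@(k∉S , _ , ¬k~) with part-walk-out part b∈ w k∉ single S⊆A sep
    ... | c , c∈S , rest with a ≟ c
    ...   | yes refl = rest
    ...   | no a≢c = step (x∈p∩q⁺ (a∈A , a∈))
              (inj₂ (subst (Single G) (pair-unique S (proj₁ (proj₁ single)) a≢c a∈S c∈S) single)) rest
      where
      a∈S : a ∈ S
      a∈S = decidable-stable (a ∈? S) λ a∉S → ¬k~ a∈A a∉S (conn-edge (Adj-sym e) k∉S a∉S)
    part-walk-out part b∈ (here _) a∉ = contradiction b∈ a∉
    part-walk-out {A} {S = S} part b∈ (step {y = k} _ e w) a∉ single S⊆A (a∉S , ne , ¬a~) with k ∈? A
    ... | yes k∈ = k , k∈S , part-walk-in part b∈ w k∈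
      where
      k∈S : k ∈ S
      k∈S = decidable-stable (k ∈? S) λ k∉S → ¬a~ k∈ k∉S (conn-edge e a∉S k∉S)
    -- The same `S` serves for the whole excursion: it lies in `A`, so no vertex outside `A` belongs
    -- to it.
    ... | no k∉ = part-walk-out part b∈ w k∉ single S⊆A
      (k∉S , ne , λ y∈ y∉ k~y → ¬a~ y∈ y∉ (conn-edge e a∉S k∉S ++ʷ k~y))
      where
      k∉S : k ∉ S
      k∉S = k∉ ∘ S⊆A

    part-walk : Part G A → a ∈ A → b ∈ A → Conn R a b → Walk (Adj' G) (A ∩ ∁ R) a b
    part-walk part a∈ b∈ c = part-walk-in part b∈ c a∈

    -- Shrinking the component of a vertex cut off from the rest of its part

    record Isolated (A : Subset n) (x : V) : Set where
      field
        {around}  : Subset n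
        cut       : Cutset2 G around
        x∉around  : x ∉ around
        alone     : ∀ {z} → z ∈ A → Conn around x z → z ≡ x
        -- `around` will limit the neighbours of `x` in `G'(A)`; `through` shows that `x` lies on a
        -- 2-vertex cutset, as criticality requires.
        {through} : Subset n
        cutT      : Cutset2 G through
        x∈through : x ∈ through

    module _ (part : Part G A) where

      split-nonsingle : Splits G R A → ¬ Single G R
      split-nonsingle sp single = proj₁ part _ single sp

      -- Crossing R = {a , b} by {p , q} with p ≠ x yields the cutset {a , p} (or {b , p}) with a smaller
      -- component of x.
      shrink₁ : Crossed x₁ a b p q → x₁ ≢ p → Conn (pair p q) x₁ a → x₁ ∉ pair a b →
        x₂ ∉ pair a b → ¬ Conn (pair a b) x₁ x₂ →
        ∃[ R ] (Cutset2 G R × x₁ ∉ R × x₂ ∉ R × ¬ Conn R x₁ x₂ × comp R x₁ ⊂ comp (pair a b) x₁)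
      shrink₁ {x₁} {a} {b} {p} {q} {x₂} cr x₁≢p x₁~a x₁∉ x₂∉ ¬x₁x₂ =
        pair a p , mkCutset2 (∣pair∣≡2 a p a≢p) x₁∉′ x₂∉′ ¬x₁x₂′ , x₁∉′ , x₂∉′ , ¬x₁x₂′ ,
        (λ v∈ → ∈⟪⟫⁺ (conn? (pair a b) x₁) (inside′ (∈⟪⟫⁻ (conn? (pair a p) x₁) v∈))) ,
        p , ∈⟪⟫⁺ (conn? (pair a b) x₁) x~p , λ p∈ → conn-∉ʳ (∈⟪⟫⁻ (conn? (pair a p) x₁) p∈) (∈pairʳ a p)
        where
        open Crossed cr
        a≢p : a ≢ p
        a≢p refl = a∉T (∈pairˡ p q)
        inside′ : Conn (pair a p) x₁ v → Conn (pair a b) x₁ v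
        inside′ = confine cr (conn-refl x₁∉) x₁~a
        x₁∉′ : x₁ ∉ pair a p
        x₁∉′ = ∉pair (λ { refl → x₁∉ (∈pairˡ a b) }) x₁≢p
        x₂∉′ : x₂ ∉ pair a p
        x₂∉′ = ∉pair (λ { refl → x₂∉ (∈pairˡ a b) }) λ { refl → ¬x₁x₂ x~p }
        ¬x₁x₂′ : ¬ Conn (pair a p) x₁ x₂
        ¬x₁x₂′ = ¬x₁x₂ ∘ inside′

      -- If {x , q} crosses {a , b} and A has a further vertex z on the side of x and a, then some {u , v}
      -- crosses {a , x} with u next to z, and {u , b} has a smaller component of x.
      shrink₂ : Crossed x₁ a b x₁ q → x₁ ∉ pair a b → x₂ ∈ A → x₂ ∉ pair a b → ¬ Conn (pair a b) x₁ x₂ →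
        z ∈ A → Conn (pair a b) x₁ z → z ≢ x₁ → Conn (pair x₁ q) z a →
        ∃[ R ] (Cutset2 G R × x₁ ∉ R × x₂ ∉ R × ¬ Conn R x₁ x₂ × comp R x₁ ⊂ comp (pair a b) x₁)
      shrink₂ {x} {a} {b} {q} {y} {z} cr x∉ y∈A y∉ ¬xy z∈A x~z z≢x z~a =
        -- By `confine`, `{a , x}` separates `z` from `y`; it splits `A`, so it is not single and is
        -- crossed by some `{u , v}`.
        result (crossed cut₂ (split-nonsingle (splitsOf ¬zy z∈A z∉₂ y∈A y∉₂)) z∉₂ y∉₂ ¬zy)
        where
        open Crossed cr
        inside₂ : Conn (pair a b) x w → Conn (pair x q) w a → Conn (pair a x) w v → Conn (pair a b) x v
        inside₂ = confine cr
        ¬zy : ¬ Conn (pair a x) z y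
        ¬zy = ¬xy ∘ inside₂ x~z z~a
        z∉₂ : z ∉ pair a x
        z∉₂ = ∉pair (λ { refl → conn-∉ʳ x~z (∈pairˡ a b) }) z≢x
        y∉₂ : y ∉ pair a x
        y∉₂ = ∉pair (λ { refl → y∉ (∈pairˡ a b) }) λ { refl → ¬xy (conn-refl x∉) }
        cut₂ : Cutset2 G (pair a x)
        cut₂ = mkCutset2 (∣pair∣≡2 a x λ { refl → x∉ (∈pairˡ a b) }) z∉₂ y∉₂ ¬zy
        Result : Set
        Result = ∃[ R ] (Cutset2 G R × x ∉ R × y ∉ R × ¬ Conn R x y × comp R x ⊂ comp (pair a b) x)
        result : ∃[ u ] ∃[ v ] (Cutset2 G (pair u v) × Crossed z a x u v × Conn (pair a x) y v) → Result
        result (u , v , _ , cr₂ , y~v) =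
          pair u b , mkCutset2 (∣pair∣≡2 u b u≢b) x∉₃ y∉₃ (¬xy ∘ inside₃) , x∉₃ , y∉₃ , ¬xy ∘ inside₃ ,
          (λ w∈ → ∈⟪⟫⁺ (conn? (pair a b) x) (inside₃ (∈⟪⟫⁻ (conn? (pair u b) x) w∈))) ,
          u , ∈⟪⟫⁺ (conn? (pair a b) x) x~u , λ u∈ → conn-∉ʳ (∈⟪⟫⁻ (conn? (pair u b) x) u∈) (∈pairˡ u b)
          where
          module C₂ = Crossed cr₂
          x~u : Conn (pair a b) x u
          x~u = inside₂ x~z z~a C₂.x~p
          u≢b : u ≢ b
          u≢b refl = conn-∉ʳ x~u (∈pairʳ a b)
          x∉₃ : x ∉ pair u b
          x∉₃ = ∉pair (λ { refl → C₂.b∉T (∈pairˡ u v) }) λ { refl → x∉ (∈pairʳ a b) }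
          y∉₃ : y ∉ pair u b
          y∉₃ = ∉pair (λ { refl → ¬xy x~u }) λ { refl → y∉ (∈pairʳ a b) }
          inner : Subset n
          inner = comp (pair a b) x ∩ ∁ (pair u b)
          inner-x⊆ : w ∈ inner - x → w ∉ pair a x × w ≢ u
          inner-x⊆ {w} w∈ with x∈p∩q⁻ (comp (pair a b) x) (∁ (pair u b)) (p-x⊆p w∈)
          ... | w∈H , w∉₃ =
            ∉pair (λ { refl → conn-∉ʳ (∈⟪⟫⁻ (conn? (pair a b) x) w∈H) (∈pairˡ a b) })
                  (λ { refl → x∉p-x inner x w∈ }) ,
            λ { refl → x∈∁p⇒x∉p w∉₃ (∈pairˡ u b) }
          -- After its last visit to `x` the walk stays in one component of `G − {a , x}`, on the
          -- side of `a`. It cannot meet `v`, which is joined to `y` there, because `confine` keeps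
          -- that component away from `y`.
          to-a : Conn (pair a b) x h → Walk (Adj G) inner x h → Adj G h a → Conn (pair u v) x a
          to-a {h} x~h x⇝h e with Walk-fromStart x⇝h
          ... | inj₁ refl = conn-edge e C₂.b∉T C₂.a∉T
          ... | inj₂ (z′ , xz′ , z′⇝h) = step (x∉p⇒x∈∁p C₂.b∉T) xz′
                  (Walk-snoc (Walk-transfer z′⇝h avoid) e (x∉p⇒x∈∁p C₂.a∉T))
            where
            h~a : Conn (pair x q) h a
            h~a = conn-edge e (∉pair (λ { refl → x∉p-x inner x (Walk-end z′⇝h) }) λ { refl → x≁q x~h }) a∉T
            z′~ : Walk (Adj G) (inner - x) z′ w → Conn (pair a x) z′ w
            z′~ = Walk-mono (x∉p⇒x∈∁p ∘ proj₁ ∘ inner-x⊆)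
            avoid : ∀ w → Walk (Adj G) (inner - x) z′ w → w ∈ ∁ (pair u v)
            avoid w z′⇝w = x∉p⇒x∈∁p (∉pair (proj₂ (inner-x⊆ (Walk-end z′⇝w))) λ { refl →
              ¬xy (inside₂ x~h h~a (conn-sym (z′~ z′⇝h) ++ʷ (z′~ z′⇝w ++ʷ conn-sym y~v))) })
          -- With `b` deleted the only exit is `a`, and reaching `a` would, by `to-a`, join `x` to
          -- `a` although `{u , v}` separates them.
          inside₃ : Conn (pair u b) x w → Conn (pair a b) x w
          inside₃ {w} x~w = decidable-stable (conn? (pair a b) x w) λ ¬x~w → absurd ¬x~w
            where
            absurd : ¬ ¬ Conn (pair a b) x w
            absurd ¬x~w with exitComp {U₁ = inner} (λ v∈ c → x∈p∩q⁺ (∈⟪⟫⁺ (conn? (pair a b) x) c , v∈))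
                               x~w (conn-refl x∉) ¬x~w
            ... | h , k , x~h , x⇝h , hk , k∈ , k∈R with ∈pair⁻ k∈R
            ...   | inj₁ refl = C₂.¬ab (conn-sym (to-a x~h x⇝h hk))
            ...   | inj₂ refl = x∈∁p⇒x∉p k∈ (∈pairʳ u b)

      -- Cross `R` by `{p , q}` with `p` on the side of `x₁`. If `p` differs from `x₁`, `shrink₁`
      -- applies with whichever of `a`, `b` is joined to `x₁`. If `p` is `x₁`, either no other
      -- vertex of `A` shares its component, or such a vertex allows `shrink₂`.
      isolate-step : x₁ ∈ A → x₂ ∈ A → Cutset2 G R → x₁ ∉ R → x₂ ∉ R → ¬ Conn R x₁ x₂ →
        Isolated A x₁ ⊎ ∃[ R′ ] (Cutset2 G R′ × x₁ ∉ R′ × x₂ ∉ R′ × ¬ Conn R′ x₁ x₂ × comp R′ x₁ ⊂ comp R x₁)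
      isolate-step {x} {y} {R} x∈ y∈ cut x∉ y∉ ¬xy with ∣p∣≡2⇒pair R (proj₁ cut)
      ... | a , b , a≢b , refl with crossed cut (split-nonsingle (splitsOf ¬xy x∈ x∉ y∈ y∉)) x∉ y∉ ¬xy
      ... | p , q , cutT , cr , _ = dichotomy (x ≟ p)
        where
        Smaller : Subset n → Set
        Smaller R = ∃[ R′ ] (Cutset2 G R′ × x ∉ R′ × y ∉ R′ × ¬ Conn R′ x y × comp R′ x ⊂ comp R x)
        flip-ab : {P : Subset n → Set} → P (pair a b) → P (pair b a)
        flip-ab {P} = subst P (pair-comm a b)
        flip-ba : {P : Subset n → Set} → P (pair b a) → P (pair a b)
        flip-ba {P} = subst P (pair-comm b a)
        dichotomy : Dec (x ≡ p) → Isolated A x ⊎ Smaller (pair a b)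
        dichotomy (no x≢p) with side cr (conn-refl x∉) x≢p
        ... | inj₁ x~a = inj₂ (shrink₁ cr x≢p x~a x∉ y∉ ¬xy)
        ... | inj₂ x~b = inj₂ (flip-ba {Smaller} (shrink₁ (crossed-swap cr) x≢p x~b
              (flip-ab {x ∉_} x∉) (flip-ab {y ∉_} y∉) (flip-ab {λ R → ¬ Conn R x y} ¬xy)))
        dichotomy (yes refl) with any? (λ z → z ∈? A ×-dec conn? (pair a b) x z ×-dec ¬? (z ≟ x))
        ... | no ¬r = inj₁ (record
              { cut = cut ; x∉around = x∉ ; cutT = cutT ; x∈through = ∈pairˡ x q
              ; alone = λ {z} z∈ c → decidable-stable (z ≟ x) λ z≢x → ¬r (z , z∈ , c , z≢x) })
        ... | yes (z , z∈ , x~z , z≢x) with side cr x~z z≢x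
        ...   | inj₁ z~a = inj₂ (shrink₂ cr x∉ y∈ y∉ ¬xy z∈ x~z z≢x z~a)
        ...   | inj₂ z~b = inj₂ (flip-ba {Smaller} (shrink₂ (crossed-swap cr)
              (flip-ab {x ∉_} x∉) y∈ (flip-ab {y ∉_} y∉) (flip-ab {λ R → ¬ Conn R x y} ¬xy)
              z∈ (flip-ab {λ R → Conn R x z} x~z) z≢x z~b))

      isolate : ∀ k → ∣ comp R x₁ ∣ < k →
        x₁ ∈ A → x₂ ∈ A → Cutset2 G R → x₁ ∉ R → x₂ ∉ R → ¬ Conn R x₁ x₂ → Isolated A x₁
      isolate (suc k) (s≤s le) x∈ y∈ cut x∉ y∉ ¬xy with isolate-step x∈ y∈ cut x∉ y∉ ¬xy
      ... | inj₁ iso = iso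
      ... | inj₂ (R′ , cut′ , x∉′ , y∉′ , ¬xy′ , smaller) =
        isolate k (ℕₚ.≤-trans (p⊂q⇒∣p∣<∣q∣ smaller) le) x∈ y∈ cut′ x∉′ y∉′ ¬xy′

      separated⇒isolated : x₁ ∈ A → x₂ ∈ A → Cutset2 G R → x₁ ∉ R → x₂ ∉ R → ¬ Conn R x₁ x₂ → Isolated A x₁
      separated⇒isolated = isolate _ ℕₚ.≤-refl

    -- Parts split by some 2-vertex cutset

    attach-∈ : ∣ R ∣ ≡ 2 → a ∈ R → x₁ ∉ R → ∃[ h ] (Conn R x₁ h × Adj G h a)
    attach-∈ {R} eq a∈ x∉ with ∣p∣≡2⇒pair R eq
    ... | c , d , c≢d , refl with ∈pair⁻ a∈
    ...   | inj₁ refl = attach c≢d x∉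
    ...   | inj₂ refl rewrite pair-comm c d = attach (≢-sym c≢d) x∉

    -- `v` has neighbours in two components of `G − R`, and as `v` is interior they lie in `A`.
    interior-split : Part G A → v ∈ A → Interior v → Cutset2 G R → v ∈ R → Splits G R A
    interior-split part v∈A int cut v∈R with cutset2-split cut
    ... | x , y , x∉ , y∉ , ¬xy with attach-∈ (proj₁ cut) v∈R x∉ | attach-∈ (proj₁ cut) v∈R y∉
    ...   | h , x~h , hv | k , y~k , kv =
      splitsOf (λ h~k → ¬xy (x~h ++ʷ (h~k ++ʷ conn-sym y~k)))
        (interior-nbr part v∈A int (Adj-sym hv)) (conn-∉ʳ x~h)
        (interior-nbr part v∈A int (Adj-sym kv)) (conn-∉ʳ y~k)

    linked : Part G A → a ∈ A → b ∈ A → Walk (Adj' G) A a b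
    linked {A} part a∈ b∈ = Walk-mono (λ m → proj₁ (x∈p∩q⁻ A (∁ ⊥) m))
      (part-walk part a∈ b∈ (connected₁ (subst (_< 2) (sym (∣⊥∣≡0 n)) (s≤s z≤n)) ∉⊥ ∉⊥))

    -- A walk from x to a another vertex of A that avoids c starts with an edge to a neighbour other than c.
    nbr≢ : Part G A → 3 ≤ ∣ A ∣ → x₁ ∈ A → x₁ ≢ c → ∃[ k ] (k ∈ A × k ≢ c × Adj' G x₁ k)
    nbr≢ {A} {x} {c} part 3≤ x∈ x≢c
      with ∣p∣<∣q∣⇒∃ (pair x c) A (subst (_< ∣ A ∣) (sym (∣pair∣≡2 x c x≢c)) 3≤)
    ... | y , y∈ , y∉ with exit {U₁ = ⊤} (_≟ x) (λ _ _ → ∈⊤)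
          (part-walk part x∈ y∈ (connected-⁅⁆ x≢c λ { refl → y∉ (∈pairʳ x c) }))
          refl (λ { refl → y∉ (∈pairˡ x c) })
    ... | _ , k , refl , _ , e , k∈ , _ with x∈p∩q⁻ A (∁ ⁅ c ⁆) k∈
    ...   | k∈A , k∈∁ = k , k∈A , x∉⁅y⁆⇒x≢y (x∈∁p⇒x∉p k∈∁) , e

    -- A neighbour outside `around` would share the component of `x` and so equal `x`. By `nbr≢`
    -- neither vertex of `around` is the only neighbour, so both are neighbours.
    isolated⇒twoNbrs : Part G A → 3 ≤ ∣ A ∣ → x₁ ∈ A → Isolated A x₁ → TwoNbrs A x₁
    isolated⇒twoNbrs {A} {x} part 3≤ x∈
      record { around = R ; cut = cut ; x∉around = x∉around ; alone = alone } with ∣p∣≡2⇒pair R (proj₁ cut)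
    ... | a , b , a≢b , refl = record
      { l≢r = a≢b
      ; l∈ = proj₁ (other b-case) ; r∈ = proj₁ (other a-case)
      ; xl = proj₂ (other b-case) ; xr = proj₂ (other a-case)
      ; only = only }
      where
      only : ∀ {z} → z ∈ A → Adj' G x z → z ≡ a ⊎ z ≡ b
      only {z} z∈ e = ∈pair⁻ (decidable-stable (z ∈? pair a b) λ z∉ →
        Adj′-irrefl (subst (Adj' G x) (alone z∈ (conn-Adj′ cut e x∉around z∉)) e))
      a-case : ∃[ k ] (k ≡ b × k ∈ A × Adj' G x k)
      a-case with nbr≢ part 3≤ x∈ (λ { refl → x∉around (∈pairˡ a b) })
      ... | k , k∈ , k≢a , e with only k∈ e
      ...   | inj₁ k≡a = contradiction k≡a k≢a
      ...   | inj₂ k≡b = k , k≡b , k∈ , e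
      b-case : ∃[ k ] (k ≡ a × k ∈ A × Adj' G x k)
      b-case with nbr≢ part 3≤ x∈ (λ { refl → x∉around (∈pairʳ a b) })
      ... | k , k∈ , k≢b , e with only k∈ e
      ...   | inj₁ k≡a = k , k≡a , k∈ , e
      ...   | inj₂ k≡b = contradiction k≡b k≢b
      other : ∀ {v} → ∃[ k ] (k ≡ v × k ∈ A × Adj' G x k) → v ∈ A × Adj' G x v
      other (_ , refl , k∈ , e) = k∈ , e

    -- If `a` were not in `A`, deleting `{a , b}` would remove from `A` at most `b`, and `G'(A)`
    -- stays connected without `b`.
    split-pair-∈ : Part G A → Cutset2 G (pair a b) → Splits G (pair a b) A → a ∈ A
    split-pair-∈ {A} {a} {b} part cut (y , z , y∈ , y∉ , z∈ , z∉ , ¬yz) =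
      decidable-stable (a ∈? A) λ a∉ → ¬yz (conn-Walk′ cut (Walk-mono (restrict a∉)
        (part-walk part y∈ z∈ (connected-⁅⁆ (λ { refl → y∉ (∈pairʳ a b) }) λ { refl → z∉ (∈pairʳ a b) }))))
      where
      restrict : a ∉ A → A ∩ ∁ ⁅ b ⁆ ⊆ A ∩ ∁ (pair a b)
      restrict a∉ m with x∈p∩q⁻ A (∁ ⁅ b ⁆) m
      ... | w∈ , w∈∁ = x∈p∩q⁺ (w∈ ,
        x∉p⇒x∈∁p (∉pair (λ { refl → a∉ w∈ }) (x∉⁅y⁆⇒x≢y (x∈∁p⇒x∉p w∈∁))))

    split-⊆ : Part G A → Cutset2 G R → Splits G R A → R ⊆ A
    split-⊆ {R = R} part cut sp with ∣p∣≡2⇒pair R (proj₁ cut)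
    ... | a , b , _ , refl = pair⊆ (split-pair-∈ part cut sp)
      (split-pair-∈ part (subst (Cutset2 G) (pair-comm a b) cut) (subst (λ R → Splits G R _) (pair-comm a b) sp))

    split⇒4≤ : Cutset2 G R → R ⊆ A → Splits G R A → 4 ≤ ∣ A ∣
    split⇒4≤ {R = R} cut R⊆ (y , z , y∈ , y∉ , z∈ , z∉ , ¬yz) with ∣p∣≡2⇒pair R (proj₁ cut)
    ... | a , b , a≢b , refl = 4≤∣p∣ (R⊆ (∈pairˡ a b)) (R⊆ (∈pairʳ a b)) y∈ z∈ (≢-sym a≢b)
      (λ { refl → y∉ (∈pairˡ a b) }) (λ { refl → z∉ (∈pairˡ a b) })
      (λ { refl → y∉ (∈pairʳ a b) }) (λ { refl → z∉ (∈pairʳ a b) }) λ { refl → ¬yz (conn-refl y∉) }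

    cutset2⇒4≤n : Cutset2 G R → 4 ≤ n
    cutset2⇒4≤n cut with cutset2-split cut
    ... | y , z , y∉ , z∉ , ¬yz =
      subst (4 ≤_) (∣⊤∣≡n n) (split⇒4≤ cut ⊆⊤ (splitsOf ¬yz ∈⊤ y∉ ∈⊤ z∉))

    -- Outside `R`, `x` is separated from `y` or from `z`. If `x` is in `R`, some `T` splits `R`
    -- because `R` is not single; this separates `x` from the other vertex of `R`, which lies in
    -- `A`.
    split⇒isolated : Part G A → Cutset2 G R → Splits G R A → x₁ ∈ A → Isolated A x₁
    split⇒isolated {A} {R} {x} part cut sp@(y , z , y∈ , y∉ , z∈ , z∉ , ¬yz) x∈ with x ∈? R
    ... | no x∉ with conn? R x y
    ...   | no ¬xy = separated⇒isolated part x∈ y∈ cut x∉ y∉ ¬xy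
    ...   | yes xy = separated⇒isolated part x∈ z∈ cut x∉ z∉ λ xz → ¬yz (conn-sym xy ++ʷ xz)
    split⇒isolated {A} {R} {x} part cut sp x∈ | yes x∈R
      with nonsingle-split cut (split-nonsingle part sp)
    ... | T , cutT , c , d , c∈ , c∉ , d∈ , d∉ , ¬cd with x ≟ c | x ≟ d
    ...   | yes refl | _        = separated⇒isolated part x∈ (split-⊆ part cut sp d∈) cutT c∉ d∉ ¬cd
    ...   | no _     | yes refl = separated⇒isolated part x∈ (split-⊆ part cut sp c∈) cutT d∉ c∉ (¬cd ∘ conn-sym)
    ...   | no x≢c   | no x≢d   = contradiction
        (3≤∣p∣ x∈R c∈ d∈ (≢-sym x≢c) (≢-sym x≢d) λ { refl → ¬cd (conn-refl c∉) })
        (subst (λ k → ¬ 3 ≤ k) (sym (proj₁ cut)) λ { (s≤s (s≤s ())) })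

    degree≡2 : a ≢ b → Adj G v a → Adj G v b → (∀ {z} → Adj G v z → z ≡ a ⊎ z ≡ b) → degree G v ≡ 2
    degree≡2 {a} {b} {v} a≢b va vb only = trans (cong ∣_∣ (⊆-antisym sub sup)) (∣pair∣≡2 a b a≢b)
      where
      ∈nbrs⁺ : Adj G v w → w ∈ tabulate (adj G v)
      ∈nbrs⁺ {w} e = lookup⇒[]= w _ (trans (lookup∘tabulate _ w) (Equivalence.to T-≡ e))
      sub : tabulate (adj G v) ⊆ pair a b
      sub {w} m with only (Equivalence.from T-≡ (trans (sym (lookup∘tabulate _ w)) ([]=⇒lookup m)))
      ... | inj₁ refl = ∈pairˡ a b
      ... | inj₂ refl = ∈pairʳ a b
      sup : pair a b ⊆ tabulate (adj G v)
      sup = pair⊆ (∈nbrs⁺ va) (∈nbrs⁺ vb)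

    interior-Adj′ : Interior v → Adj' G v u → Adj G v u
    interior-Adj′ int (inj₁ e)             = e
    interior-Adj′ {v} {u} int (inj₂ single) = contradiction (∈pairˡ v u) (int _ single)

    interior-degree : Part G A → v ∈ A → Interior v → TwoNbrs A v → degree G v ≡ 2
    interior-degree part v∈ int N = degree≡2 l≢r (interior-Adj′ int xl) (interior-Adj′ int xr)
      λ e → only (interior-nbr part v∈ int e) (inj₁ e)
      where open TwoNbrs N

    abstract
      split-part : Part G A → Cutset2 G R → Splits G R A →
        IsCycle G A × 4 ≤ ∣ A ∣ × (∀ {v} → v ∈ A → Interior v → degree G v ≡ 2)
      split-part {A} part cut sp@(y , _ , y∈ , _) =
        Cycle.isCycle A nbrs (linked part) y y∈ , 4≤ , λ v∈ int → interior-degree part v∈ int (nbrs v∈)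
        where
        4≤ : 4 ≤ ∣ A ∣
        4≤ = split⇒4≤ cut (split-⊆ part cut sp) sp
        nbrs : ∀ {x} → x ∈ A → TwoNbrs A x
        nbrs x∈ = isolated⇒twoNbrs part (ℕₚ.≤-trans (ℕₚ.n≤1+n 3) 4≤) x∈ (split⇒isolated part cut sp x∈)

    -- Criticality and 2-vertex cutsets

    -- A set of at most one vertex disconnecting `G − x` is not empty, as `G` is biconnected; its
    -- vertex `w` completes the cutset.
    critical-cut : 4 ≤ n → ¬ KConnected (Adj G) (∁ ⁅ x₁ ⁆) 2 → ∃[ w ] Cutset2 G (pair x₁ w)
    critical-cut {x} 4≤n ¬k with any? (λ w → cutset2? (pair x w))
    ... | yes r = r
    ... | no ¬r = contradiction (size , conn) ¬k
      where
      size : 2 < ∣ ∁ ⁅ x ⁆ ∣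
      size = subst (2 <_) (sym (trans (∣∁p∣≡n∸∣p∣ ⁅ x ⁆) (cong (n ∸_) (∣⁅x⁆∣≡1 x))))
        (ℕₚ.∸-monoˡ-≤ 1 4≤n)
      conn : ∀ R → R ⊆ ∁ ⁅ x ⁆ → ∣ R ∣ < 2 → ¬ Disconnected (Adj G) (∁ ⁅ x ⁆ ∩ ∁ R)
      conn R R⊆ lt (y , z , y∈ , z∈ , ¬yz)
        with x∈p∩q⁻ (∁ ⁅ x ⁆) (∁ R) y∈ | x∈p∩q⁻ (∁ ⁅ x ⁆) (∁ R) z∈ | nonempty? R
      ... | y∈₁ , _ | z∈₁ , _ | no empty = ¬yz (Walk-mono
              (λ w∈ → x∈p∩q⁺ (w∈ , x∉p⇒x∈∁p λ w∈R → empty (_ , w∈R)))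
              (connected-⁅⁆ (x∉⁅y⁆⇒x≢y (x∈∁p⇒x∉p y∈₁)) (x∉⁅y⁆⇒x≢y (x∈∁p⇒x∉p z∈₁))))
      ... | y∈₁ , y∈₂ | z∈₁ , z∈₂ | yes (w , w∈) = ¬r (w , mkCutset2 (∣pair∣≡2 x w x≢w)
              (∉xw y∈₁ y∈₂) (∉xw z∈₁ z∈₂) (¬yz ∘ Walk-mono inside′))
        where
        x≢w : x ≢ w
        x≢w refl = x∈∁p⇒x∉p (R⊆ w∈) (x∈⁅x⁆ x)
        ∉xw : ∀ {y} → y ∈ ∁ ⁅ x ⁆ → y ∈ ∁ R → y ∉ pair x w
        ∉xw y∈₁ y∈₂ = ∉pair (x∉⁅y⁆⇒x≢y (x∈∁p⇒x∉p y∈₁)) λ { refl → x∈∁p⇒x∉p y∈₂ w∈ }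
        inside′ : ∁ (pair x w) ⊆ ∁ ⁅ x ⁆ ∩ ∁ R
        inside′ {v} v∈ = x∈p∩q⁺ (x∉p⇒x∈∁p (x≢y⇒x∉⁅y⁆ λ { refl → v∉ (∈pairˡ x w) }) , x∉p⇒x∈∁p λ v∈R →
          ℕₚ.<⇒≱ lt (1+∣p-x∣≤∣p∣ w∈ (ℕₚ.≤-trans (s≤s z≤n)
            (x∈p⇒∣p-x∣<∣p∣ (x∈p∧x≢y⇒x∈p-y v∈R λ { refl → v∉ (∈pairʳ x w) })))))
          where
          v∉ : v ∉ pair x w
          v∉ = x∈∁p⇒x∉p v∈

    cut-¬biconnected : Cutset2 G (pair a b) → ¬ KConnected (Adj G) (∁ ⁅ a ⁆) 2
    cut-¬biconnected {a} {b} cut (_ , conn) with cutset2-split cut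
    ... | y , z , y∉ , z∉ , ¬yz =
      conn ⁅ b ⁆ (λ { {w} w∈ → x∉p⇒x∈∁p (x≢y⇒x∉⁅y⁆ λ { refl → b≢a (sym (x∈⁅y⁆⇒x≡y b w∈)) }) })
        (subst (_< 2) (sym (∣⁅x⁆∣≡1 b)) ℕₚ.≤-refl)
        (y , z , out y∉ , out z∉ , ¬yz ∘ Walk-mono in′)
      where
      b≢a : b ≢ a
      b≢a refl with trans (sym (proj₁ cut)) (trans (cong ∣_∣ (∪-idem ⁅ a ⁆)) (∣⁅x⁆∣≡1 a))
      ... | ()
      out : ∀ {y} → y ∉ pair a b → y ∈ ∁ ⁅ a ⁆ ∩ ∁ ⁅ b ⁆
      out y∉ = x∈p∩q⁺ (x∉p⇒x∈∁p (y∉ ∘ x∈p∪q⁺ ∘ inj₁) , x∉p⇒x∈∁p (y∉ ∘ x∈p∪q⁺ ∘ inj₂))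
      in′ : ∁ ⁅ a ⁆ ∩ ∁ ⁅ b ⁆ ⊆ ∁ (pair a b)
      in′ w∈ with x∈p∩q⁻ (∁ ⁅ a ⁆) (∁ ⁅ b ⁆) w∈
      ... | w∈₁ , w∈₂ = x∉p⇒x∈∁p (∉pair (x∉⁅y⁆⇒x≢y (x∈∁p⇒x∉p w∈₁)) (x∉⁅y⁆⇒x≢y (x∈∁p⇒x∉p w∈₂)))

    critical-split : Critical G → Part G A → v ∈ A → Interior v → ∃[ R ] (Cutset2 G R × Splits G R A)
    critical-split {v = v} (_ , 4≤n , crit) part v∈ int with critical-cut 4≤n (crit v)
    ... | w , cut = pair v w , cut , interior-split part v∈ int cut (∈pairˡ v w)

    -- An interior vertex yields a cutset splitting `A`. It lies inside `A`, so it disconnects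
    -- `G'(A)`, and it forces `A` to have at least four vertices.
    critical⇒emptyInterior : Critical G → Part G A → IsBlock G A ⊎ (IsCycle G A × ∣ A ∣ ≡ 3) → EmptyInterior G A
    critical⇒emptyInterior {A} critical part kind v v∈ int =
      let R , cut , sp = critical-split critical part v∈ int in absurd cut sp kind
      where
      absurd : Cutset2 G R → Splits G R A → ¬ (IsBlock G A ⊎ (IsCycle G A × ∣ A ∣ ≡ 3))
      absurd {R} cut sp@(y , z , y∈ , y∉ , z∈ , z∉ , ¬yz) (inj₁ (_ , conn)) =
        conn R (split-⊆ part cut sp) (ℕₚ.≤-reflexive (cong suc (proj₁ cut)))
          (y , z , x∈p∩q⁺ (y∈ , x∉p⇒x∈∁p y∉) , x∈p∩q⁺ (z∈ , x∉p⇒x∈∁p z∉) , ¬yz ∘ conn-Walk′ cut)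
      absurd cut sp (inj₂ (_ , eq)) = ℕₚ.<-irrefl (sym eq) (proj₁ (proj₂ (split-part part cut sp)))

    graph-nbr≢ : x₁ ≢ c → ∃[ k ] (Adj G x₁ k × k ≢ c)
    graph-nbr≢ {x} {c} x≢c
      with ∣p∣<∣q∣⇒∃ (pair x c) ⊤ (subst (_< ∣ ⊤ {n} ∣) (sym (∣pair∣≡2 x c x≢c)) (proj₁ bic))
    ... | y , _ , y∉ with exit {U₁ = ⊤} (_≟ x) (λ _ _ → ∈⊤)
          (connected-⁅⁆ {b = y} x≢c λ { refl → y∉ (∈pairʳ x c) }) refl (λ { refl → y∉ (∈pairˡ x c) })
    ... | _ , k , refl , _ , e , k∈ , _ = k , e , x∉⁅y⁆⇒x≢y (x∈∁p⇒x∉p k∈)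

    another : (a : V) → 2 ≤ ∣ A ∣ → ∃[ c ] (c ∈ A × a ≢ c)
    another {A} a 2≤ with ∣p∣<∣q∣⇒∃ ⁅ a ⁆ A (subst (_< ∣ A ∣) (sym (∣⁅x⁆∣≡1 a)) 2≤)
    ... | c , c∈ , c∉ = c , c∈ , λ { refl → c∉ (x∈⁅x⁆ a) }

    interior⇒3≤ : Part G A → x₁ ∈ A → Interior x₁ → 3 ≤ ∣ A ∣
    interior⇒3≤ {A} {x} part x∈ int with another {⊤} x (ℕₚ.≤-trans (ℕₚ.n≤1+n 2) (proj₁ bic))
    ... | c , _ , x≢c with graph-nbr≢ x≢c
    ... | k , xk , _ with graph-nbr≢ (λ { refl → Adj-irrefl xk })
    ... | l , xl , l≢k = 3≤∣p∣ x∈ (interior-nbr part x∈ int xk) (interior-nbr part x∈ int xl)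
      (λ { refl → Adj-irrefl xk }) (λ { refl → Adj-irrefl xl }) l≢k

    triangle : Part G A → ∣ A ∣ ≡ 3 → x₁ ∈ A → IsCycle G A
    triangle {A} {x} part eq x∈ = Cycle.isCycle A nbrs (linked part) x x∈
      where
      3≤ : 3 ≤ ∣ A ∣
      3≤ = ℕₚ.≤-reflexive (sym eq)
      nbrs : ∀ {y} → y ∈ A → TwoNbrs A y
      nbrs {y} y∈ with another {A} y (ℕₚ.≤-trans (ℕₚ.n≤1+n 2) 3≤)
      ... | c , _ , y≢c with nbr≢ part 3≤ y∈ y≢c
      ... | k , k∈ , _ , yk with nbr≢ part 3≤ y∈ (λ { refl → Adj′-irrefl yk })
      ... | l , l∈ , l≢k , yl = record
        { l≢r = l≢k ; l∈ = l∈ ; r∈ = k∈ ; xl = yl ; xr = yk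
        ; only = λ {z} z∈ e → ∈pair⁻ (decidable-stable (z ∈? pair l k) λ z∉ → ℕₚ.<-irrefl (sym eq)
            (4≤∣p∣ y∈ k∈ l∈ z∈ (λ { refl → Adj′-irrefl yk }) (λ { refl → Adj′-irrefl yl })
              (λ { refl → Adj′-irrefl e }) l≢k (λ { refl → z∉ (∈pairʳ l k) }) λ { refl → z∉ (∈pairˡ l k) })) }

    -- `part-walk` turns connections in `G − R` into walks in `G'(A)` avoiding `R`, so a
    -- disconnecting `R` would be a 2-vertex cutset splitting `A`.
    unsplit-block : Part G A → (∀ {R} → Cutset2 G R → ¬ Splits G R A) → 3 < ∣ A ∣ → IsBlock G A
    unsplit-block {A} part ¬split 3< = 3< , conn
      where
      conn : ∀ R → R ⊆ A → ∣ R ∣ < 3 → ¬ Disconnected (Adj' G) (A ∩ ∁ R)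
      conn R _ (s≤s le) (y , z , y∈ , z∈ , ¬yz) with x∈p∩q⁻ A (∁ R) y∈ | x∈p∩q⁻ A (∁ R) z∈
      ... | y∈A , y∈∁ | z∈A , z∈∁ = connect (ℕₚ.m≤n⇒m<n∨m≡n le)
        where
        y∉ : y ∉ R
        y∉ = x∈∁p⇒x∉p y∈∁
        z∉ : z ∉ R
        z∉ = x∈∁p⇒x∉p z∈∁
        ¬conn : ¬ Conn R y z
        ¬conn = ¬yz ∘ part-walk part y∈A z∈A
        connect : ¬ (∣ R ∣ < 2 ⊎ ∣ R ∣ ≡ 2)
        connect (inj₁ lt) = ¬conn (connected₁ lt y∉ z∉)
        connect (inj₂ eq) = ¬split (mkCutset2 eq y∉ z∉ ¬conn) (splitsOf ¬conn y∈A y∉ z∈A z∉)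

    EmptyBlocks : Set
    EmptyBlocks = ∀ A → Part G A → IsBlock G A ⊎ (IsCycle G A × ∣ A ∣ ≡ 3) → EmptyInterior G A

    -- If no cutset contains `x`, the vertices that no single cutset separates from `x` form a part
    -- `B` with `x` in its interior. A cutset splitting `B` would make `x` isolated and so put it on
    -- a cutset; hence `B` is a block or a triangle, whose interior is empty by hypothesis.
    in-cutset : EmptyBlocks → ∀ x → ∃[ R ] (Cutset2 G R × x ∈ R)
    in-cutset empty x with someSubset? (λ R → cutset2? R ×-dec x ∈? R)
    ... | yes r = r
    ... | no ¬r = contradiction int (empty B part (kind (ℕₚ.m≤n⇒m<n∨m≡n (interior⇒3≤ part x∈ int))) x x∈)
      where
      int : Interior x
      int S (cut , _) x∈S = ¬r (S , cut , x∈S)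
      Near : V → Set
      Near v = ∀ S → Single G S → v ∉ S → Conn S v x
      near? : Decidable Near
      near? v = allSubset? λ S → single? S →-dec ¬? (v ∈? S) →-dec conn? S v x
      B : Subset n
      B = ⟪ near? ⟫
      x∈ : x ∈ B
      x∈ = ∈⟪⟫⁺ near? λ S _ x∉ → conn-refl x∉
      part : Part G B
      part = (λ { S single (y , z , y∈ , y∉ , z∈ , z∉ , ¬yz) →
               ¬yz (∈⟪⟫⁻ near? y∈ S single y∉ ++ʷ conn-sym (∈⟪⟫⁻ near? z∈ S single z∉)) })
           , away
        where
        away : ∀ v → v ∉ B → ∃[ S ] (Single G S × Separates G S ⁅ v ⁆ B)
        away v v∉ with someSubset? (λ S → single? S ×-dec ¬? (v ∈? S) ×-dec ¬? (conn? S v x))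
        ... | no ¬s = contradiction (∈⟪⟫⁺ near? λ S single v∉S →
                decidable-stable (conn? S v x) λ ¬c → ¬s (S , single , v∉S , ¬c)) v∉
        ... | yes (S , single , v∉S , ¬c) = S , single , Sep⇒separates
                (v∉S , (x , x∈ , int S single) , λ y∈ y∉ vy → ¬c (vy ++ʷ ∈⟪⟫⁻ near? y∈ S single y∉))
      isolated-absurd : ¬ Isolated B x
      isolated-absurd iso = ¬r (_ , Isolated.cutT iso , Isolated.x∈through iso)
      ¬split : Cutset2 G R → ¬ Splits G R B
      ¬split cut sp = isolated-absurd (split⇒isolated part cut sp x∈)
      kind : 3 < ∣ B ∣ ⊎ 3 ≡ ∣ B ∣ → IsBlock G B ⊎ (IsCycle G B × ∣ B ∣ ≡ 3)
      kind (inj₁ 3<) = inj₁ (unsplit-block part ¬split 3<)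
      kind (inj₂ eq) = inj₂ (triangle part (sym eq) x∈ , sym eq)

    emptyBlocks⇒critical : EmptyBlocks → Critical G
    emptyBlocks⇒critical empty = bic , 4≤n , λ x → not-biconnected x (in-cutset empty x)
      where
      4≤n : 4 ≤ n
      4≤n with ∣p∣<∣q∣⇒∃ ⊥ ⊤ (subst (_< ∣ ⊤ {n} ∣) (sym (∣⊥∣≡0 n)) (ℕₚ.≤-trans (s≤s z≤n) (proj₁ bic)))
      ... | x , _ = cutset2⇒4≤n (proj₁ (proj₂ (in-cutset empty x)))
      not-biconnected : ∀ x → ∃[ R ] (Cutset2 G R × x ∈ R) → ¬ KConnected (Adj G) (∁ ⁅ x ⁆) 2
      not-biconnected x (R , cut , x∈) with ∣p∣≡2⇒pair R (proj₁ cut)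
      ... | a , b , _ , refl with ∈pair⁻ x∈
      ...   | inj₁ refl = cut-¬biconnected cut
      ...   | inj₂ refl = cut-¬biconnected (subst (Cutset2 G) (pair-comm a b) cut)

    -- Terminal parts

    -- A single `S′` through `v` is not contained in `A`, else it would be `S`. For `w` in `S′`
    -- outside `A`, the separating cutset inside `A` must be `S`, which then splits `S′`, against
    -- independence.
    terminal-interior : TerminalWith G A S → v ∈ A → v ∉ S → Interior v
    terminal-interior {A} {S} {v} (part , single , _ , unique) v∈ v∉ S′ single′ v∈S′
      with any? (λ w → w ∈? S′ ×-dec ¬? (w ∈? A))
    ... | no ¬r = v∉ (subst (v ∈_) (unique S′ single′ λ {w} w∈ →
            decidable-stable (w ∈? A) λ w∉ → ¬r (w , w∈ , w∉)) v∈S′)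
    ... | yes (w , w∈ , w∉) with part-sep-inside part w∉
    ... | S″ , single″ , S″⊆ , w∉S″ , _ , ¬w~ with unique S″ single″ S″⊆
    ... | refl = ¬w~ v∈ v∉ (unsplit (proj₁ (proj₂ single S′ (proj₁ single′))) w∈ w∉S″ v∈S′ v∉)

    terminal-nonempty : TerminalWith G A S → ∃[ v ] (v ∈ A × v ∉ S)
    terminal-nonempty {A} {S} (part , single , _ , unique)
      with ∣p∣<∣q∣⇒∃ S ⊤ (subst (_< ∣ ⊤ {n} ∣) (sym (proj₁ (proj₁ single))) (proj₁ bic))
    ... | v , _ , v∉S with v ∈? A
    ...   | yes v∈ = v , v∈ , v∉S
    ...   | no v∉ with part-sep-inside part v∉
    ...     | S′ , single′ , S′⊆ , _ , ne , _ with unique S′ single′ S′⊆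
    ...       | refl = ne

    abstract
      terminal-cycle : Critical G → TerminalWith G A S →
        IsCycle G A × 4 ≤ ∣ A ∣ × (∀ v → v ∈ A → v ∉ S → degree G v ≡ 2)
      terminal-cycle critical term@(part , _) =
        let x , x∈ , x∉ = terminal-nonempty term
            R , cut , sp = critical-split critical part x∈ (terminal-interior term x∈ x∉)
            cycle , 4≤ , deg = split-part part cut sp
        in cycle , 4≤ , λ v v∈ v∉ → deg v∈ (terminal-interior term v∈ v∉)

    Minimal : Subset n → V → Set
    Minimal S x = ∀ {T z} → Single G T → z ∉ T → ¬ comp T z ⊂ comp S x

    minimal-comp : ∀ k → ∣ comp S x₁ ∣ < k → Single G S → x₁ ∉ S →
      ∃[ T ] ∃[ z ] (Single G T × z ∉ T × comp T z ⊆ comp S x₁ × Minimal T z)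
    minimal-comp {S} {x} (suc k) (s≤s le) single x∉
      with someSubset? (λ T → any? λ z → single? T ×-dec ¬? (z ∈? T) ×-dec comp T z ⊂? comp S x)
    ... | no ¬r = S , x , single , x∉ , (λ m → m) , λ singleT z∉ sub → ¬r (_ , _ , singleT , z∉ , sub)
    ... | yes (T , z , singleT , z∉ , sub)
      with minimal-comp k (ℕₚ.≤-trans (p⊂q⇒∣p∣<∣q∣ sub) le) singleT z∉
    ... | T′ , z′ , singleT′ , z′∉ , sub′ , min = T′ , z′ , singleT′ , z′∉ , proj₁ sub ∘ sub′ , min

    Deg2Pair : Subset n → V → Set
    Deg2Pair S x = ∃[ v ] ∃[ w ] (v ≢ w × Conn S x v × Conn S x w × degree G v ≡ 2 × degree G w ≡ 2)

    module Leaf {S : Subset n} {x : V} (single : Single G S) (x∉ : x ∉ S) (minimal : Minimal S x) where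

      L : Subset n
      L = comp S x ∪ S

      ∈L⁻ : v ∈ L → v ∉ S → Conn S x v
      ∈L⁻ v∈ v∉ with x∈p∪q⁻ (comp S x) S v∈
      ... | inj₁ v∈H = ∈⟪⟫⁻ (conn? S x) v∈H
      ... | inj₂ v∈S = contradiction v∈S v∉

      ∈L⁺ : Conn S x v → v ∈ L
      ∈L⁺ c = x∈p∪q⁺ (inj₁ (∈⟪⟫⁺ (conn? S x) c))

      -- A component of G − T that misses S but borders on the component of x is strictly smaller.
      no-smaller : Single G T′ → Conn S x w → w ∈ T′ → u ∉ T′ → ∃[ s ] (s ∈ S × Conn T′ u s)
      no-smaller {T} {t} {u} singleT x~t t∈ u∉ with any? (λ s → s ∈? S ×-dec conn? T u s)
      ... | yes r = r
      ... | no ¬r = contradiction smaller (minimal singleT u∉)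
        where
        disj : ∀ {w} → Conn T u w → w ∉ S
        disj c w∈ = ¬r (_ , w∈ , c)
        x~u : Conn S x u
        x~u = x~t ++ʷ conn-sym (bridge (proj₁ (proj₁ singleT)) u∉ disj t∈ (conn-∉ʳ x~t))
        smaller : comp T u ⊂ comp S x
        smaller = (λ w∈ → ∈⟪⟫⁺ (conn? S x) (x~u ++ʷ conn-transfer disj (∈⟪⟫⁻ (conn? T u) w∈)))
                , t , ∈⟪⟫⁺ (conn? S x) x~t , λ t∈K → conn-∉ʳ (∈⟪⟫⁻ (conn? T u) t∈K) t∈

      -- Otherwise, by `no-smaller`, every component of `G − T′` meets `S`; but `T′` does not split
      -- `S`, so there would be only one component.
      misses : Single G T′ → Conn S x w → w ∉ T′
      misses {T} singleT x~t t∈ with cutset2-split (proj₁ singleT)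
      ... | u , v , u∉ , v∉ , ¬uv with no-smaller singleT x~t t∈ u∉ | no-smaller singleT x~t t∈ v∉
      ... | s , s∈ , us | s′ , s′∈ , vs′ = ¬uv (us ++ʷ (unsplit
              (proj₂ (proj₂ single T (proj₁ singleT))) s∈ (conn-∉ʳ us) s′∈ (conn-∉ʳ vs′) ++ʷ conn-sym vs′))

      -- A single cutset misses the component of `x`, which thus stays connected and keeps the
      -- remaining vertices of `S` attached. Vertices outside `L` are separated from it by `S`
      -- itself.
      part : Part G L
      part = (λ { T singleT (y , z , y∈ , y∉ , z∈ , z∉ , ¬yz) →
               ¬yz (conn-sym (near singleT y∈ y∉) ++ʷ near singleT z∈ z∉) })
           , λ v v∉ → S , single , Sep⇒separates
               ( (λ v∈S → v∉ (x∈p∪q⁺ (inj₂ v∈S)))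
               , (x , ∈L⁺ (conn-refl x∉) , x∉)
               , λ y∈ y∉ vy → v∉ (∈L⁺ (∈L⁻ y∈ y∉ ++ʷ conn-sym vy)))
        where
        near : Single G T′ → v ∈ L → v ∉ T′ → Conn T′ x v
        near {v = v} singleT v∈ v∉ with v ∈? S
        ... | yes v∈S = bridge (proj₁ (proj₁ single)) x∉ (misses singleT) v∈S v∉
        ... | no v∉S  = conn-transfer (misses singleT) (∈L⁻ v∈ v∉S)

      terminal : TerminalWith G L S
      terminal = part , single , (λ v∈ → x∈p∪q⁺ (inj₂ v∈)) , unique
        where
        unique : ∀ T → Single G T → T ⊆ L → T ≡ S
        unique T singleT T⊆ with ∣p∣≡2⇒pair T (proj₁ (proj₁ singleT))
        ... | a , b , a≢b , refl =
          sym (pair-unique S (proj₁ (proj₁ single)) a≢b (in-S (∈pairˡ a b)) (in-S (∈pairʳ a b)))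
          where
          in-S : ∀ {v} → v ∈ T → v ∈ S
          in-S {v} v∈ = decidable-stable (v ∈? S) λ v∉ → misses singleT (∈L⁻ (T⊆ v∈) v∉) v∈

      degrees : Critical G → Deg2Pair S x
      degrees critical with terminal-cycle critical terminal
      ... | _ , 4≤ , deg with ∣p∣<∣q∣⇒∃ S L
            (ℕₚ.≤-trans (s≤s (ℕₚ.≤-reflexive (proj₁ (proj₁ single)))) (ℕₚ.≤-trans (ℕₚ.n≤1+n 3) 4≤))
      -- `L` has at least four vertices and `S` only two, so a second vertex is left besides `v`.
      ... | v , v∈ , v∉ with ∣p∣<∣q∣⇒∃ (S ∪ ⁅ v ⁆) L (ℕₚ.≤-trans (s≤s (ℕₚ.≤-trans (∣p∪q∣≤∣p∣+∣q∣ S ⁅ v ⁆)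
            (ℕₚ.≤-reflexive (trans (cong (_+ ∣ ⁅ v ⁆ ∣) (proj₁ (proj₁ single))) (cong (2 +_) (∣⁅x⁆∣≡1 v)))))) 4≤)
      ... | w , w∈ , w∉ = v , w , (λ { refl → w∉ (x∈p∪q⁺ (inj₂ (x∈⁅x⁆ v))) }) ,
        ∈L⁻ v∈ v∉ , ∈L⁻ w∈ w∉S , deg v v∈ v∉ , deg w w∈ w∉S
        where
        w∉S : w ∉ S
        w∉S w∈S = w∉ (x∈p∪q⁺ (inj₁ w∈S))

    component-degrees : Critical G → Single G S → x₁ ∉ S → Deg2Pair S x₁
    component-degrees {S} {x} critical single x∉ =
      let T , z , singleT , z∉ , sub , min = minimal-comp _ ℕₚ.≤-refl single x∉
          v , w , v≢w , z~v , z~w , dv , dw = Leaf.degrees singleT z∉ min critical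
          lift : ∀ {v} → Conn T z v → Conn S x v
          lift c = ∈⟪⟫⁻ (conn? S x) (sub (∈⟪⟫⁺ (conn? T z) c))
      in v , w , v≢w , lift z~v , lift z~w , dv , dw

    -- Counting the vertices of degree 2

    deg2? : Decidable (λ v → degree G v ≡ 2)
    deg2? v = degree G v ℕₚ.≟ 2

    -- Two sides of a single cutset supply two vertices each. Without single cutsets the whole
    -- vertex set is a part consisting of interior vertices; criticality gives a cutset splitting
    -- it, so all degrees are 2.
    four-degree2 : Critical G → 4 ≤ numDeg2 G
    four-degree2 critical with someSubset? single?
    ... | yes (S , single) =
      let x , y , x∉ , y∉ , ¬xy = cutset2-split (proj₁ single)
          a , b , a≢b , xa , xb , da , db = component-degrees critical single x∉
          c , d , c≢d , yc , yd , dc , dd = component-degrees critical single y∉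
          apart : ∀ {v w} → Conn S x v → Conn S y w → w ≢ v
          apart xv yw w≡v = ¬xy (xv ++ʷ subst (λ v → Conn S v y) w≡v (conn-sym yw))
      in 4≤∣p∣ (∈⟪⟫⁺ deg2? da) (∈⟪⟫⁺ deg2? db) (∈⟪⟫⁺ deg2? dc) (∈⟪⟫⁺ deg2? dd)
           (≢-sym a≢b) (apart xa yc) (apart xa yd) (apart xb yc) (apart xb yd) (≢-sym c≢d)
    ... | no ¬single =
      ℕₚ.≤-trans (subst (4 ≤_) (sym (∣⊤∣≡n n)) (proj₁ (proj₂ critical)))
        (p⊆q⇒∣p∣≤∣q∣ {p = ⊤} λ _ → ∈⟪⟫⁺ deg2? (deg _))
      where
      interior : ∀ v → Interior v
      interior v S single _ = ¬single (S , single)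
      part : Part G ⊤
      part = (λ S single _ → ¬single (S , single)) , λ v v∉ → contradiction ∈⊤ v∉
      deg : ∀ v → degree G v ≡ 2
      deg v =
        let _ , cut , sp = critical-split critical part (∈⊤ {x = v}) (interior v)
        in proj₂ (proj₂ (split-part part cut sp)) ∈⊤ (interior v)

theorem6 : ((n : ℕ) (G : Graph n) → Biconnected G →
    (Critical G ⇔
    (∀ (A : Subset n) → Part G A → (IsBlock G A ⊎ (IsCycle G A × ∣ A ∣ ≡ 3)) →
    EmptyInterior G A)))
    ×
    ((n : ℕ) (G : Graph n) → Critical G → (A S : Subset n) → TerminalWith G A S →
    IsCycle G A × 4 ≤ ∣ A ∣ × (∀ v → v ∈ A → v ∉ S → degree G v ≡ 2))
    ×
    ((n : ℕ) (G : Graph n) → Critical G → 4 ≤ numDeg2 G)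
theorem6 =
  (λ n G bic → let open Cuts.Biconn G bic in
    mk⇔ (λ critical A part kind → critical⇒emptyInterior critical part kind) emptyBlocks⇒critical) ,
  (λ n G critical A S term → Cuts.Biconn.terminal-cycle G (proj₁ critical) critical term) ,
  λ n G critical → Cuts.Biconn.four-degree2 G (proj₁ critical) critical
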